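{- Let $G=(V,E,W)$ be a finite connected weighted graph and let $\sigma$ be an inconsistent $d$-dimensional signature on $G$. Let $\rho$ denote the nullity of the connection Laplacian $\mathcal{L}^\sigma$. Then there exists a $(d-\rho)$-dimensional signature $\tau$ on $G$ such that $\mathcal{L}^\tau$ is invertible and $$\sigma\cong \Big(\bigoplus_{i=1}^{\rho}\iota^1\Big)\oplus\tau .$$
   Context: $G=(V,E,W)$: $V=\{1,\dots,n\}$, $E$ a set of undirected edges without loops or multiple edges, symmetric weights $w_{ij}>0$ iff $\{i,j\}\in E$, $\deg(i)=\sum_{j\sim i}w_{ij}$. The oriented edges are $E^{\mathrm{or}}=\{(i,j),(j,i):\{i,j\}\in E\}$. A $d$-dimensional signature is a map $\sigma:E^{\mathrm{or}}\to\mathsf{O}(d)$ with $\sigma_{ji}=\sigma_{ij}^{ -1}=\sigma_{ij}^{\mathrm T}$. Its connection Laplacian $\mathcal{L}^\sigma$ is the $nd\times nd$ block matrix with $d\times d$ blocks $\mathcal{L}_{ii}=\deg(i)I_d$, $\mathcal{L}_{ij}=-w_{ij}\sigma_{ij}$ if $i\sim j$, and $0$ otherwise. $\sigma$ is consistent if the product of $\sigma$ along every directed cycle is $I_d$, and inconsistent otherwise. Two $d$-dimensional signatures satisfy $\sigma\cong\tau$ (switching equivalence) if there is $f:V\to\mathsf{O}(d)$ with $f(i)\sigma_{ij}=\tau_{ij}f(j)$ for all $(i,j)\in E^{\mathrm{or}}$. For a $d$-dimensional signature $\sigma$ and a $d'$-dimensional signature $\sigma'$, the direct sum is $(\sigma\oplus\sigma')_{ij}=\begin{bmatrix}\sigma_{ij}&0\\0&\sigma'_{ij}\end{bmatrix}$.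 $\iota^1$ denotes the $1$-dimensional signature identically equal to $1$. -}

module Defs where

open import Algebra.Bundles using (CommutativeRing)
import Algebra.Properties.Semiring.Sum as SemiringSum
open import Data.Bool.Base using (if_then_else_)
open import Data.Fin.Base using (Fin; zero; suc; _↑ˡ_; _↑ʳ_; splitAt; join; quotient; remainder)
import Data.Fin.Properties as Fin
open import Data.List.Base using (List; []; _∷_; length)
open import Data.List.Relation.Unary.Unique.Propositional using (Unique)
open import Data.Nat.Base as ℕ using (ℕ; zero; suc)
open import Data.Product.Base using (Σ-syntax; ∃-syntax; _×_; _,_; proj₁; proj₂)
open import Data.Sum.Base using (_⊎_; inj₁; inj₂)
open import Data.Vec.Functional using (Vector)
open import Function.Base using (_∘_)
open import Function.Bundles using (_⇔_)
open import Level using (Level; 0ℓ) renaming (suc to lsuc; _⊔_ to _⊔ˡ_)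
open import Relation.Binary.Core using (Rel)
open import Relation.Binary.Construct.Closure.ReflexiveTransitive using (Star; ε; _◅_)
open import Relation.Binary.Definitions using (Decidable; Symmetric)
import Relation.Binary.Definitions as B
open import Relation.Binary.PropositionalEquality as ≡ using (_≡_; refl)
open import Relation.Binary.Structures using (IsStrictTotalOrder)
open import Relation.Nullary using (¬_; does; yes; no; contradiction)
open import Relation.Unary using (Pred)

-- The real numbers, presented axiomatically as a Dedekind-complete ordered
-- field.  Classically this determines ℝ up to isomorphism.  Trichotomy of the
-- order (part of IsStrictTotalOrder) is a classical assumption about ℝ.
record RealNumbers (a : Level) : Set (lsuc a) where
  infix 4 _<_ _≤_
  field
    commutativeRing : CommutativeRing a a

  open CommutativeRing commutativeRing public

  field
    _<_                : Rel Carrier a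
    isStrictTotalOrder : IsStrictTotalOrder _≈_ _<_
    0<1                : 0# < 1#
    +-monoˡ-<          : ∀ {x y} z → x < y → x + z < y + z
    *-pos              : ∀ {x y} → 0# < x → 0# < y → 0# < x * y
    inverse            : ∀ x → ¬ (x ≈ 0#) → ∃[ y ] (x * y ≈ 1#)

  _≤_ : Rel Carrier a
  x ≤ y = ¬ (y < x)

  UpperBound : Pred Carrier a → Pred Carrier a
  UpperBound P u = ∀ x → P x → x ≤ u

  field
    supremum : (P : Pred Carrier a) → ∃[ x ] P x → ∃[ u ] UpperBound P u →
               ∃[ s ] (UpperBound P s × (∀ u → UpperBound P u → s ≤ u))

module Connection {a : Level} (ℝ : RealNumbers a) where

  open RealNumbers ℝ hiding (refl; zero)
  open SemiringSum semiring using (sum; sum-syntax; sum-cong-≋; sum-replicate-zero)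
  private module ≈ = RealNumbers ℝ

  Matrix : ℕ → ℕ → Set a
  Matrix m n = Fin m → Fin n → Carrier

  infix 4 _≋_
  _≋_ : ∀ {m n} → Rel (Matrix m n) a
  A ≋ B = ∀ i j → A i j ≈ B i j

  infixl 7 _·_
  _·_ : ∀ {m n p} → Matrix m n → Matrix n p → Matrix m p
  _·_ {n = n} A B i j = ∑[ k < n ] (A i k * B k j)

  infix 8 _ᵀ
  _ᵀ : ∀ {m n} → Matrix m n → Matrix n m
  (A ᵀ) i j = A j i

  𝕀 : ∀ {n} → Matrix n n
  𝕀 i j = if does (i Fin.≟ j) then 1# else 0#

  IsInverse : ∀ {n} → Rel (Matrix n n) a
  IsInverse A B = (A · B ≋ 𝕀) × (B · A ≋ 𝕀)

  Invertible : ∀ {n} → Pred (Matrix n n) a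
  Invertible A = ∃[ B ] IsInverse A B

  Orthogonal : ∀ {n} → Pred (Matrix n n) a
  Orthogonal A = IsInverse A (A ᵀ)

  Kernel : ∀ {m n} → Matrix m n → Pred (Vector Carrier n) a
  Kernel {n = n} A v = ∀ i → ∑[ j < n ] (A i j * v j) ≈ 0#

  combination : ∀ {k n} → Vector Carrier k → Vector (Vector Carrier n) k → Vector Carrier n
  combination {k} c b i = ∑[ l < k ] (c l * b l i)

  LinearlyIndependent : ∀ {k n} → Vector (Vector Carrier n) k → Set a
  LinearlyIndependent b = ∀ c → (∀ i → combination c b i ≈ 0#) → ∀ l → c l ≈ 0#

  record IsBasis {n k} (S : Pred (Vector Carrier n) a)
                 (b : Vector (Vector Carrier n) k) : Set a where
    field
      members     : ∀ l → S (b l)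
      independent : LinearlyIndependent b
      spanning    : ∀ v → S v → ∃[ c ] (∀ i → v i ≈ combination c b i)

  HasNullity : ∀ {m n} → Matrix m n → ℕ → Set a
  HasNullity {n = n} A k = Σ[ b ∈ Vector (Vector Carrier n) k ] IsBasis (Kernel A) b

  -- The i-th summand of a splitting of the index selects a block.
  blockEntry : ∀ {m n p q} → Matrix m n → Matrix p q → Fin m ⊎ Fin p → Fin n ⊎ Fin q → Carrier
  blockEntry A B (inj₁ i) (inj₁ j) = A i j
  blockEntry A B (inj₁ i) (inj₂ j) = 0#
  blockEntry A B (inj₂ i) (inj₁ j) = 0#
  blockEntry A B (inj₂ i) (inj₂ j) = B i j

  infixr 6 _⊞_
  _⊞_ : ∀ {m n p q} → Matrix m n → Matrix p q → Matrix (m ℕ.+ p) (n ℕ.+ q)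
  _⊞_ {m} {n} A B x y = blockEntry A B (splitAt m x) (splitAt n y)

  sum-splitAt : ∀ m {n} (t : Vector Carrier (m ℕ.+ n)) →
                sum t ≈ sum (t ∘ (_↑ˡ n)) + sum (t ∘ (m ↑ʳ_))
  sum-splitAt zero    t = ≈.sym (+-identityˡ _)
  sum-splitAt (suc m) t = ≈.trans (+-congˡ (sum-splitAt m (t ∘ suc))) (≈.sym (+-assoc _ _ _))

  sum-zero : ∀ {n} (t : Vector Carrier n) → (∀ i → t i ≈ 0#) → sum t ≈ 0#
  sum-zero {n} t t≈0 = ≈.trans (sum-cong-≋ t≈0) (sum-replicate-zero n)

  blockEntry-· : ∀ {m n p m′ n′ p′} (A : Matrix m n) (B : Matrix m′ n′)
                 (C : Matrix n p) (D : Matrix n′ p′) u v →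
                 sum (λ k → blockEntry A B u (inj₁ k) * blockEntry C D (inj₁ k) v) +
                 sum (λ k → blockEntry A B u (inj₂ k) * blockEntry C D (inj₂ k) v)
                 ≈ blockEntry (A · C) (B · D) u v
  blockEntry-· {n′ = n′} A B C D (inj₁ i) (inj₁ j) =
    ≈.trans (+-congˡ (sum-zero {n′} (λ _ → 0# * 0#) (λ _ → zeroˡ _))) (+-identityʳ _)
  blockEntry-· A B C D (inj₁ i) (inj₂ j) =
    ≈.trans (+-cong (sum-zero (λ k → A i k * 0#) (λ _ → zeroʳ _))
                    (sum-zero (λ k → 0# * D k j) (λ _ → zeroˡ _)))
            (+-identityʳ _)
  blockEntry-· A B C D (inj₂ i) (inj₁ j) =
    ≈.trans (+-cong (sum-zero (λ k → 0# * C k j) (λ _ → zeroˡ _))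
                    (sum-zero (λ k → B i k * 0#) (λ _ → zeroʳ _)))
            (+-identityʳ _)
  blockEntry-· {n = n} A B C D (inj₂ i) (inj₂ j) =
    ≈.trans (+-congʳ (sum-zero {n} (λ _ → 0# * 0#) (λ _ → zeroˡ _))) (+-identityˡ _)

  blockEntry-cong : ∀ {m n p q} {A A′ : Matrix m n} {B B′ : Matrix p q} → A ≋ A′ → B ≋ B′ →
                    ∀ u v → blockEntry A B u v ≈ blockEntry A′ B′ u v
  blockEntry-cong A≋ B≋ (inj₁ i) (inj₁ j) = A≋ i j
  blockEntry-cong A≋ B≋ (inj₁ i) (inj₂ j) = ≈.refl
  blockEntry-cong A≋ B≋ (inj₂ i) (inj₁ j) = ≈.refl
  blockEntry-cong A≋ B≋ (inj₂ i) (inj₂ j) = B≋ i j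

  blockEntry-ᵀ : ∀ {m n p q} (A : Matrix m n) (B : Matrix p q) u v →
                 blockEntry A B v u ≈ blockEntry (A ᵀ) (B ᵀ) u v
  blockEntry-ᵀ A B (inj₁ i) (inj₁ j) = ≈.refl
  blockEntry-ᵀ A B (inj₁ i) (inj₂ j) = ≈.refl
  blockEntry-ᵀ A B (inj₂ i) (inj₁ j) = ≈.refl
  blockEntry-ᵀ A B (inj₂ i) (inj₂ j) = ≈.refl

  𝕀-diag : ∀ {n} (i : Fin n) → 𝕀 i i ≈ 1#
  𝕀-diag i with i Fin.≟ i
  ... | yes _  = ≈.refl
  ... | no i≢i = contradiction refl i≢i

  𝕀-off : ∀ {n} {i j : Fin n} → ¬ (i ≡ j) → 𝕀 i j ≈ 0#
  𝕀-off {i = i} {j} i≢j with i Fin.≟ j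
  ... | yes i≡j = contradiction i≡j i≢j
  ... | no _    = ≈.refl

  𝕀⊞𝕀 : ∀ m n → 𝕀 {m} ⊞ 𝕀 {n} ≋ 𝕀
  𝕀⊞𝕀 m n x y with x Fin.≟ y
  ... | yes refl = diag (splitAt m x)
    where
    diag : ∀ u → blockEntry 𝕀 𝕀 u u ≈ 1#
    diag (inj₁ i) = 𝕀-diag i
    diag (inj₂ i) = 𝕀-diag i
  ... | no x≢y = off (splitAt m x) (splitAt m y) λ eq →
          x≢y (≡.trans (≡.sym (Fin.join-splitAt m n x))
              (≡.trans (≡.cong (join m n) eq) (Fin.join-splitAt m n y)))
    where
    off : ∀ u v → ¬ (u ≡ v) → blockEntry 𝕀 𝕀 u v ≈ 0#
    off (inj₁ i) (inj₁ j) u≢v = 𝕀-off (u≢v ∘ ≡.cong inj₁)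
    off (inj₁ i) (inj₂ j) u≢v = ≈.refl
    off (inj₂ i) (inj₁ j) u≢v = ≈.refl
    off (inj₂ i) (inj₂ j) u≢v = 𝕀-off (u≢v ∘ ≡.cong inj₂)

  ⊞-· : ∀ {m n p m′ n′ p′} (A : Matrix m n) (B : Matrix m′ n′)
        (C : Matrix n p) (D : Matrix n′ p′) →
        (A ⊞ B) · (C ⊞ D) ≋ (A · C) ⊞ (B · D)
  ⊞-· {m} {n} {p} {m′} {n′} A B C D x y =
    ≈.trans (sum-splitAt n _)
      (≈.trans (+-cong (sum-cong-≋ left) (sum-cong-≋ right))
               (blockEntry-· A B C D (splitAt m x) (splitAt p y)))
    where
    term : Fin n ⊎ Fin n′ → Carrier
    term k = blockEntry A B (splitAt m x) k * blockEntry C D k (splitAt p y)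

    left : ∀ k → term (splitAt n (k ↑ˡ n′)) ≈ term (inj₁ k)
    left k = ≈.reflexive (≡.cong term (Fin.splitAt-↑ˡ n k n′))

    right : ∀ k → term (splitAt n (n ↑ʳ k)) ≈ term (inj₂ k)
    right k = ≈.reflexive (≡.cong term (Fin.splitAt-↑ʳ n n′ k))

  ⊞-ᵀ : ∀ {m n p q} (A : Matrix m n) (B : Matrix p q) → (A ⊞ B) ᵀ ≋ A ᵀ ⊞ B ᵀ
  ⊞-ᵀ {m} {n} A B x y = blockEntry-ᵀ A B (splitAt n x) (splitAt m y)

  ⊞-cong : ∀ {m n p q} {A A′ : Matrix m n} {B B′ : Matrix p q} →
           A ≋ A′ → B ≋ B′ → A ⊞ B ≋ A′ ⊞ B′
  ⊞-cong {m} {n} A≋ B≋ x y = blockEntry-cong A≋ B≋ (splitAt m x) (splitAt n y)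

  ⊞-orthogonal : ∀ {m n} {A : Matrix m m} {B : Matrix n n} →
                 Orthogonal A → Orthogonal B → Orthogonal (A ⊞ B)
  ⊞-orthogonal {m} {n} {A} {B} (AAᵀ , AᵀA) (BBᵀ , BᵀB) =
    (λ x y → ≈.trans (sum-cong-≋ {m ℕ.+ n} (λ k → *-congˡ (⊞-ᵀ A B k y)))
      (≈.trans (⊞-· A B (A ᵀ) (B ᵀ) x y)
      (≈.trans (⊞-cong AAᵀ BBᵀ x y) (𝕀⊞𝕀 m n x y)))) ,
    (λ x y → ≈.trans (sum-cong-≋ {m ℕ.+ n} (λ k → *-congʳ (⊞-ᵀ A B x k)))
      (≈.trans (⊞-· (A ᵀ) (B ᵀ) A B x y)
      (≈.trans (⊞-cong AᵀA BᵀB x y) (𝕀⊞𝕀 m n x y))))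

  -- A loopless weighted graph on the vertex set Fin n; irrelevance of
  -- adjacency proofs expresses the absence of multiple edges.
  record WeightedGraph (n : ℕ) : Set (a ⊔ˡ lsuc 0ℓ) where
    infix 4 _∼_ _∼?_
    field
      _∼_          : Rel (Fin n) 0ℓ
      _∼?_         : Decidable _∼_
      ∼-irrelevant : B.Irrelevant _∼_
      ∼-sym        : Symmetric _∼_
      ∼-irrefl     : ∀ {i} → ¬ (i ∼ i)
      w            : Fin n → Fin n → Carrier
      w-sym        : ∀ i j → w i j ≈ w j i
      w-pos        : ∀ i j → (0# < w i j) ⇔ (i ∼ j)

    deg : Fin n → Carrier
    deg i = ∑[ j < n ] (if does (i ∼? j) then w i j else 0#)

    Connected : Set
    Connected = ∀ i j → Star _∼_ i j

    -- The vertices of a walk, without its endpoint.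
    sources : ∀ {i j} → Star _∼_ i j → List (Fin n)
    sources ε             = []
    sources (_◅_ {i} _ p) = i ∷ sources p

    IsCycle : ∀ {i} → Star _∼_ i i → Set
    IsCycle p = Unique (sources p) × 3 ℕ.≤ length (sources p)

  module _ {n : ℕ} (G : WeightedGraph n) where

    open WeightedGraph G

    record Signature (d : ℕ) : Set a where
      field
        σ          : ∀ {i j} → i ∼ j → Matrix d d
        orthogonal : ∀ {i j} (e : i ∼ j) → Orthogonal (σ e)
        reversal   : ∀ {i j} (e : i ∼ j) → σ (∼-sym e) ≋ σ e ᵀ

  module _ {n : ℕ} {G : WeightedGraph n} where

    open WeightedGraph G
    open Signature

    laplacianBlock : ∀ {d} → Signature G d → Fin n → Fin n → Matrix d d
    laplacianBlock s i j x y with i Fin.≟ j | i ∼? j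
    ... | yes _ | _     = deg i * 𝕀 x y
    ... | no _  | yes e = - w i j * σ s e x y
    ... | no _  | no _  = 0#

    -- Index i * d + x of Fin (n * d) is entry x of block i.
    laplacian : ∀ {d} → Signature G d → Matrix (n ℕ.* d) (n ℕ.* d)
    laplacian {d} s x y =
      laplacianBlock s (quotient d x) (quotient d y) (remainder {n} d x) (remainder {n} d y)

    walkProduct : ∀ {d} → Signature G d → ∀ {i j} → Star _∼_ i j → Matrix d d
    walkProduct s ε       = 𝕀
    walkProduct s (e ◅ p) = σ s e · walkProduct s p

    Consistent : ∀ {d} → Signature G d → Set a
    Consistent s = ∀ {i} (p : Star _∼_ i i) → IsCycle p → walkProduct s p ≋ 𝕀

    Inconsistent : ∀ {d} → Signature G d → Set a
    Inconsistent s = ¬ Consistent s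

    infix 4 _≅_
    _≅_ : ∀ {d} → Rel (Signature G d) a
    _≅_ {d} s t = Σ[ f ∈ (Fin n → Matrix d d) ] (∀ i → Orthogonal (f i)) ×
                  (∀ {i j} (e : i ∼ j) → f i · σ s e ≋ σ t e · f j)

    infixr 6 _⊕_
    _⊕_ : ∀ {d d′} → Signature G d → Signature G d′ → Signature G (d ℕ.+ d′)
    s ⊕ t = record
      { σ          = λ e → σ s e ⊞ σ t e
      ; orthogonal = λ e → ⊞-orthogonal (orthogonal s e) (orthogonal t e)
      ; reversal   = λ e x y → ≈.trans (⊞-cong (reversal s e) (reversal t e) x y)
                                       (≈.sym (⊞-ᵀ (σ s e) (σ t e) x y))
      }

    ι¹ : Signature G 1
    ι¹ = record
      { σ          = λ _ _ _ → 1#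
      ; orthogonal = λ _ → one , one
      ; reversal   = λ _ _ _ → ≈.refl
      }
      where
      one : (λ (_ _ : Fin 1) → 1#) · (λ (_ _ : Fin 1) → 1#) ≋ 𝕀
      one zero zero = ≈.trans (+-identityʳ _) (*-identityˡ _)

    -- The empty direct sum is the signature of dimension 0.
    ⨁ : ∀ k → Vector (Signature G 1) k → Signature G k
    ⨁ zero    _ = record
      { σ          = λ _ ()
      ; orthogonal = λ _ → (λ ()) , (λ ())
      ; reversal   = λ _ ()
      }
    ⨁ (suc k) s = s zero ⊕ ⨁ k (s ∘ suc)

{-# OPTIONS --safe #-}

-- The quadratic form of the Laplacian is half the sum of w_ij |u_i - σ_ij u_j|² over the oriented
-- edges, so its kernel consists of the families with u_i = σ_ij u_j along every edge.  On a connected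
-- graph such a family is determined by its value at one vertex r.  Hence the values of a kernel basis
-- at any vertex are independent, and ρ ≥ d would force every closed walk to have product I.  Otherwise
-- take an orthonormal basis at r whose first ρ vectors span the values of the kernel and carry it along
-- walks to all vertices: in these frames σ_ij fixes the first ρ basis vectors, hence is block diagonal
-- with blocks I and τ_ij.  A kernel vector of the Laplacian of τ extends by zero to one of the Laplacian
-- of σ whose values are orthogonal to its kernel, so it vanishes.
module Submission where

open import Defs
import Algebra.Properties.Ring as RingProperties
import Algebra.Properties.Semiring.Sum as SemiringSum
import Algebra.Solver.Ring.NaturalCoefficients.Default as NaturalCoefficients
open import Data.Bool.Base using (if_then_else_)
open import Data.Empty using (⊥-elim)
open import Data.Fin.Base
  using (Fin; zero; suc; _↑ˡ_; _↑ʳ_; splitAt; join; combine; quotient; remainder; punchIn; punchOut)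
import Data.Fin.Properties as Fin
open import Data.Nat.Base as ℕ using (ℕ; zero; suc; _∸_; _<_; s≤s)
import Data.Nat.Properties as ℕ
open import Data.Nat.Properties using (m+[n∸m]≡n; <⇒≤)
open import Data.Product.Base using (Σ-syntax; ∃-syntax; _×_; _,_; proj₁; proj₂)
open import Data.Sum.Base using (_⊎_; inj₁; inj₂; [_,_]′)
open import Data.Vec.Functional using (Vector)
open import Function.Base using (_∘_; _$_)
open import Function.Bundles using (Equivalence)
open import Level using (Level)
open import Relation.Binary.Bundles using (Setoid)
open import Relation.Binary.Construct.Closure.ReflexiveTransitive using (Star; ε; _◅_)
open import Relation.Binary.Definitions using (tri<; tri≈; tri>)
open import Relation.Binary.PropositionalEquality as ≡ using (_≡_; refl; cong; cong₂; subst)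
import Relation.Binary.Reasoning.Setoid as SetoidReasoning
open import Relation.Binary.Structures using (IsStrictTotalOrder)
open import Relation.Nullary using (¬_; Dec; does; yes; no; contradiction; ¬?; decidable-stable)
open import Relation.Unary using (Pred)

-- Order and sign rules in an ordered field.

module OrderedField {a : Level} (ℝ : RealNumbers a) where

  open RealNumbers ℝ renaming
    (_<_ to _<ʳ_; _≤_ to _≤ʳ_; refl to ≈-refl; sym to ≈-sym; trans to ≈-trans) hiding (zero)
  open RingProperties ring
  open IsStrictTotalOrder isStrictTotalOrder
    using (compare; irrefl; _≟_; <-respʳ-≈; <-respˡ-≈) renaming (trans to <-trans)
  open SetoidReasoning setoid
  open NaturalCoefficients commutativeSemiring using (solve; _:=_; _:+_; _:*_; con)

  asym : ∀ {x y} → x <ʳ y → ¬ (y <ʳ x)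
  asym x<y y<x = irrefl ≈-refl (<-trans x<y y<x)

  <-diff : ∀ {x y} → x <ʳ y → ∃[ δ ] (0# <ʳ δ × y ≈ x + δ)
  <-diff {x} {y} x<y = y - x , <-respˡ-≈ (-‿inverseʳ x) (+-monoˡ-< (- x) x<y) ,
    ≈-sym (≈-trans (≈-sym (+-assoc x y (- x))) (xyx⁻¹≈y x y))

  <-+pos : ∀ x {δ} → 0# <ʳ δ → x <ʳ x + δ
  <-+pos x {δ} 0<δ = <-respʳ-≈ (+-comm δ x) (<-respˡ-≈ (+-identityˡ x) (+-monoˡ-< x 0<δ))

  +-pos : ∀ {x y} → 0# <ʳ x → 0# <ʳ y → 0# <ʳ x + y
  +-pos 0<x 0<y = <-trans 0<x (<-+pos _ 0<y)

  neg-pos : ∀ {x} → x <ʳ 0# → 0# <ʳ - x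
  neg-pos {x} x<0 = <-respˡ-≈ (-‿inverseʳ x) (<-respʳ-≈ (+-identityˡ (- x)) (+-monoˡ-< (- x) x<0))

  pos-neg : ∀ {x} → 0# <ʳ - x → x <ʳ 0#
  pos-neg {x} 0<-x = <-respʳ-≈ (-‿inverseˡ x) (<-respˡ-≈ (+-identityˡ x) (+-monoˡ-< x 0<-x))

  square-pos : ∀ {x} → ¬ (x ≈ 0#) → 0# <ʳ x * x
  square-pos {x} x≉0 with compare x 0#
  ... | tri< x<0 _ _ = <-respʳ-≈ eq (*-pos (neg-pos x<0) (neg-pos x<0))
    where
    eq : - x * - x ≈ x * x
    eq = ≈-trans (≈-sym (-‿distribˡ-* x (- x)))
           (≈-trans (-‿cong (≈-sym (-‿distribʳ-* x x))) (-‿involutive (x * x)))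
  ... | tri≈ _ x≈0 _ = contradiction x≈0 x≉0
  ... | tri> _ _ 0<x = *-pos 0<x 0<x

  square-nonneg : ∀ x → 0# ≤ʳ x * x
  square-nonneg x with x ≟ 0#
  ... | yes x≈0 = λ x²<0 → irrefl (≈-trans (*-congʳ x≈0) (zeroˡ x)) x²<0
  ... | no  x≉0 = asym (square-pos x≉0)

  -- A negative `y` would make `x * - y` positive, and `y ≈ 0#` would make the product zero.
  *-cancel-pos : ∀ {x y} → 0# <ʳ x → 0# <ʳ x * y → 0# <ʳ y
  *-cancel-pos {x} {y} 0<x 0<xy with compare y 0#
  ... | tri< y<0 _ _ = contradiction
          (pos-neg (<-respʳ-≈ (≈-sym (-‿distribʳ-* x y)) (*-pos 0<x (neg-pos y<0)))) (asym 0<xy)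
  ... | tri≈ _ y≈0 _ = contradiction 0<xy (irrefl (≈-sym (≈-trans (*-congˡ y≈0) (zeroʳ x))))
  ... | tri> _ _ 0<y = 0<y

  nonneg-resp : ∀ {x y} → x ≈ y → 0# ≤ʳ x → 0# ≤ʳ y
  nonneg-resp x≈y 0≤x y<0 = 0≤x (<-respˡ-≈ (≈-sym x≈y) y<0)

  -- Since `0# ≤ʳ x` only denies `x <ʳ 0#`, trichotomy on `x` decides which hypothesis a negative
  -- sum would contradict.
  nonneg-+ : ∀ {x y} → 0# ≤ʳ x → 0# ≤ʳ y → 0# ≤ʳ x + y
  nonneg-+ {x} {y} 0≤x 0≤y x+y<0 with compare x 0#
  ... | tri< x<0 _ _ = 0≤x x<0
  ... | tri≈ _ x≈0 _ = 0≤y (<-respˡ-≈ (≈-trans (+-congʳ x≈0) (+-identityˡ y)) x+y<0)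
  ... | tri> _ _ 0<x = 0≤y (<-trans (<-respʳ-≈ (+-comm y x) (<-+pos y 0<x)) x+y<0)

  nonneg-+≈0 : ∀ {x y} → 0# ≤ʳ x → 0# ≤ʳ y → x + y ≈ 0# → x ≈ 0#
  nonneg-+≈0 {x} {y} 0≤x 0≤y x+y≈0 with compare x 0#
  ... | tri< x<0 _ _ = contradiction x<0 0≤x
  ... | tri≈ _ x≈0 _ = x≈0
  ... | tri> _ _ 0<x = contradiction
          (<-respʳ-≈ (≈-trans (+-comm y x) x+y≈0) (<-+pos y 0<x)) 0≤y

  *-integral : ∀ {x y} → ¬ (x ≈ 0#) → x * y ≈ 0# → y ≈ 0#
  *-integral {x} {y} x≉0 xy≈0 with z , xz≈1 ← inverse x x≉0 = begin
    y              ≈⟨ *-identityˡ y ⟨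
    1# * y         ≈⟨ *-congʳ xz≈1 ⟨
    x * z * y      ≈⟨ *-congʳ (*-comm x z) ⟩
    z * x * y      ≈⟨ *-assoc z x y ⟩
    z * (x * y)    ≈⟨ *-congˡ xy≈0 ⟩
    z * 0#         ≈⟨ zeroʳ z ⟩
    0#             ∎

  pos-nonneg-* : ∀ {x y} → 0# <ʳ x → 0# ≤ʳ y → 0# ≤ʳ x * y
  pos-nonneg-* {x} {y} 0<x 0≤y with compare y 0#
  ... | tri< y<0 _ _ = contradiction y<0 0≤y
  ... | tri≈ _ y≈0 _ = irrefl (≈-trans (*-congˡ y≈0) (zeroʳ x))
  ... | tri> _ _ 0<y = asym (*-pos 0<x 0<y)

  -- Square roots from suprema.

  square-mono : ∀ {x y} → 0# <ʳ x → x <ʳ y → x * x <ʳ y * y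
  square-mono {x} {y} 0<x x<y with δ , 0<δ , y≈x+δ ← <-diff x<y =
    <-respʳ-≈ (≈-sym (≈-trans (*-cong y≈x+δ y≈x+δ) eq))
      (<-+pos (x * x) (+-pos (+-pos (*-pos 0<x 0<δ) (*-pos 0<x 0<δ)) (*-pos 0<δ 0<δ)))
    where
    eq : (x + δ) * (x + δ) ≈ x * x + (x * δ + x * δ + δ * δ)
    eq = solve 2 (λ x δ → (x :+ δ) :* (x :+ δ) := x :* x :+ (x :* δ :+ x :* δ :+ δ :* δ)) ≈-refl x δ

  -- t = s + δ / (1 + 2s + δ) works.
  square-room : ∀ {s δ} → 0# ≤ʳ s → 0# <ʳ δ → ∃[ t ] (s <ʳ t × t * t <ʳ s * s + δ)
  square-room {s} {δ} 0≤s 0<δ = s + η , <-+pos s 0<η ,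
      <-respʳ-≈ eq (<-+pos _ (+-pos 0<η (*-pos (*-pos 0<η 0<η) 0<r)))
    where
    r = s + s + δ

    0<r : 0# <ʳ r
    0<r with compare 0# s
    ... | tri< 0<s _ _ = +-pos (+-pos 0<s 0<s) 0<δ
    ... | tri≈ _ 0≈s _ = <-respʳ-≈ (≈-trans (≈-sym (+-identityˡ δ))
            (+-congʳ (≈-trans (≈-sym (+-identityˡ 0#)) (+-cong 0≈s 0≈s)))) 0<δ
    ... | tri> _ _ s<0 = contradiction s<0 0≤s

    0<1+r : 0# <ʳ 1# + r
    0<1+r = +-pos 0<1 0<r

    recip = inverse (1# + r) λ 1+r≈0 → irrefl (≈-sym 1+r≈0) 0<1+r

    k = proj₁ recip

    0<k : 0# <ʳ k
    0<k = *-cancel-pos 0<1+r (<-respʳ-≈ (≈-sym (proj₂ recip)) 0<1)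

    η = δ * k

    0<η : 0# <ʳ η
    0<η = *-pos 0<δ 0<k

    absorb : ∀ x → x * ((1# + r) * k) ≈ x
    absorb x = ≈-trans (*-congˡ (proj₂ recip)) (*-identityʳ x)

    -- Since `η * (1# + r) ≈ δ`, the part `η * η * (1# + r)` collapses to `δ * η`, and then the
    -- terms besides `s * s` add up to `δ`.
    eq : (s + η) * (s + η) + (η + η * η * r) ≈ s * s + δ
    eq = begin
      (s + η) * (s + η) + (η + η * η * r)
        ≈⟨ solve 3 (λ s δ k →
             (s :+ δ :* k) :* (s :+ δ :* k) :+ (δ :* k :+ δ :* k :* (δ :* k) :* (s :+ s :+ δ)) :=
             s :* s :+ (δ :* k :* (con 1 :+ s :+ s) :+ δ :* (δ :* k) :* ((con 1 :+ (s :+ s :+ δ)) :* k)))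
             ≈-refl s δ k ⟩
      s * s + (η * (1# + s + s) + δ * η * ((1# + r) * k))
        ≈⟨ +-congˡ (+-congˡ (absorb (δ * η))) ⟩
      s * s + (η * (1# + s + s) + δ * η)
        ≈⟨ +-congˡ (solve 3 (λ s δ k → δ :* k :* (con 1 :+ s :+ s) :+ δ :* (δ :* k) :=
              δ :* ((con 1 :+ (s :+ s :+ δ)) :* k)) ≈-refl s δ k) ⟩
      s * s + δ * ((1# + r) * k)
        ≈⟨ +-congˡ (absorb δ) ⟩
      s * s + δ ∎

  -- t is the Newton iterate (s² + a) / 2s, for which t² = a + (δ / 2s)² and s = t + δ / 2s.
  newton : ∀ {s a δ} → 0# <ʳ s → 0# <ʳ a → 0# <ʳ δ → s * s ≈ a + δ →
           ∃[ t ] (0# <ʳ t × t <ʳ s × a <ʳ t * t)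
  newton {s} {a} {δ} 0<s 0<a 0<δ s²≈a+δ = t , *-pos (+-pos (*-pos 0<s 0<s) 0<a) 0<h ,
      <-respʳ-≈ t+δh≈s (<-+pos t 0<δh) , <-respʳ-≈ (≈-sym t²≈a+[δh]²) (<-+pos a (*-pos 0<δh 0<δh))
    where
    0<2s : 0# <ʳ s + s
    0<2s = +-pos 0<s 0<s

    recip = inverse (s + s) λ 2s≈0 → irrefl (≈-sym 2s≈0) 0<2s

    h = proj₁ recip

    0<h : 0# <ʳ h
    0<h = *-cancel-pos 0<2s (<-respʳ-≈ (≈-sym (proj₂ recip)) 0<1)

    t = (s * s + a) * h

    0<δh : 0# <ʳ δ * h
    0<δh = *-pos 0<δ 0<h

    absorb : ∀ x → x * ((s + s) * h) ≈ x
    absorb x = ≈-trans (*-congˡ (proj₂ recip)) (*-identityʳ x)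

    t+δh≈s : t + δ * h ≈ s
    t+δh≈s = begin
      (s * s + a) * h + δ * h  ≈⟨ solve 4
        (λ s a δ h → (s :* s :+ a) :* h :+ δ :* h := (s :* s :+ (a :+ δ)) :* h) ≈-refl s a δ h ⟩
      (s * s + (a + δ)) * h    ≈⟨ *-congʳ (+-congˡ s²≈a+δ) ⟨
      (s * s + s * s) * h      ≈⟨ solve 2
        (λ s h → (s :* s :+ s :* s) :* h := s :* ((s :+ s) :* h)) ≈-refl s h ⟩
      s * ((s + s) * h)        ≈⟨ absorb s ⟩
      s                        ∎

    4s²h²≈1 : s * h * (s * h) + s * h * (s * h) + (s * h * (s * h) + s * h * (s * h)) ≈ 1#
    4s²h²≈1 = begin
      s * h * (s * h) + s * h * (s * h) + (s * h * (s * h) + s * h * (s * h))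
        ≈⟨ solve 1 (λ x → x :* x :+ x :* x :+ (x :* x :+ x :* x) := (x :+ x) :* (x :+ x)) ≈-refl (s * h) ⟩
      (s * h + s * h) * (s * h + s * h)
        ≈⟨ *-cong 2sh≈1 2sh≈1 ⟩
      1# * 1#
        ≈⟨ *-identityˡ 1# ⟩
      1# ∎
      where
      2sh≈1 : s * h + s * h ≈ 1#
      2sh≈1 = ≈-trans (≈-sym (distribʳ h s s)) (proj₂ recip)

    ah[a+δ]h : a * h * (a * h + δ * h) ≈ a * (s * h * (s * h))
    ah[a+δ]h = begin
      a * h * (a * h + δ * h)  ≈⟨ *-congˡ (distribʳ h a δ) ⟨
      a * h * ((a + δ) * h)    ≈⟨ *-congˡ (*-congʳ s²≈a+δ) ⟨
      a * h * (s * s * h)      ≈⟨ solve 3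
        (λ a s h → a :* h :* (s :* s :* h) := a :* (s :* h :* (s :* h))) ≈-refl a s h ⟩
      a * (s * h * (s * h))    ∎

    t²≈a+[δh]² : t * t ≈ a + δ * h * (δ * h)
    t²≈a+[δh]² = begin
      t * t
        ≈⟨ *-cong t≈ t≈ ⟩
      (a * h + δ * h + a * h) * (a * h + δ * h + a * h)
        ≈⟨ solve 2 (λ x y → (x :+ y :+ x) :* (x :+ y :+ x) :=
             x :* (x :+ y) :+ x :* (x :+ y) :+ (x :* (x :+ y) :+ x :* (x :+ y)) :+ y :* y) ≈-refl (a * h) (δ * h) ⟩
      a * h * (a * h + δ * h) + a * h * (a * h + δ * h) +
        (a * h * (a * h + δ * h) + a * h * (a * h + δ * h)) + δ * h * (δ * h)
        ≈⟨ +-congʳ (+-cong (+-cong ah[a+δ]h ah[a+δ]h) (+-cong ah[a+δ]h ah[a+δ]h)) ⟩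
      a * (s * h * (s * h)) + a * (s * h * (s * h)) +
        (a * (s * h * (s * h)) + a * (s * h * (s * h))) + δ * h * (δ * h)
        ≈⟨ +-congʳ (solve 2 (λ a x → a :* x :+ a :* x :+ (a :* x :+ a :* x) := a :* (x :+ x :+ (x :+ x)))
             ≈-refl a (s * h * (s * h))) ⟩
      a * (s * h * (s * h) + s * h * (s * h) + (s * h * (s * h) + s * h * (s * h))) + δ * h * (δ * h)
        ≈⟨ +-congʳ (≈-trans (*-congˡ 4s²h²≈1) (*-identityʳ a)) ⟩
      a + δ * h * (δ * h) ∎
      where
      t≈ : t ≈ a * h + δ * h + a * h
      t≈ = ≈-trans (*-congʳ (+-congʳ s²≈a+δ)) (≈-trans (distribʳ h (a + δ) a) (+-congʳ (distribʳ h a δ)))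

  -- If `s * s` were too small, `square-room` would give an element of the set above `s`. If it were
  -- too large, `newton` would give an upper bound below `s`.
  supremum-square : ∀ {a s} → 0# <ʳ a → (∀ x → x * x ≤ʳ a → x ≤ʳ s) →
                    (∀ t → (∀ x → x * x ≤ʳ a → x ≤ʳ t) → s ≤ʳ t) → s * s ≈ a
  supremum-square {a} {s} 0<a upper least with compare (s * s) a
  ... | tri≈ _ s²≈a _ = s²≈a
  ... | tri< s²<a _ _ = let δ , 0<δ , a≈s²+δ = <-diff s²<a
                            t , s<t , t²<s²+δ = square-room 0≤s 0<δ
                        in contradiction s<t (upper t (asym (<-respʳ-≈ (≈-sym a≈s²+δ) t²<s²+δ)))
    where
    0≤s : 0# ≤ʳ s
    0≤s = upper 0# λ a<00 → asym 0<a (<-respʳ-≈ (zeroˡ 0#) a<00)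
  -- The Newton step divides by `s`, so `s` must first be shown positive: zero belongs to the set,
  -- and `s ≈ 0#` would force `a` below zero.
  ... | tri> _ _ a<s² with compare 0# s
  ...   | tri> _ _ s<0 = contradiction s<0 (upper 0# λ a<00 → asym 0<a (<-respʳ-≈ (zeroˡ 0#) a<00))
  ...   | tri≈ _ 0≈s _ = ⊥-elim (asym 0<a (<-respʳ-≈ (≈-trans (*-congʳ (≈-sym 0≈s)) (zeroˡ s)) a<s²))
  ...   | tri< 0<s _ _ = let δ , 0<δ , s²≈a+δ = <-diff a<s²
                             t , 0<t , t<s , a<t² = newton 0<s 0<a 0<δ s²≈a+δ
                         in contradiction t<s (least t λ x x²≤a t<x →
                              x²≤a (<-trans a<t² (square-mono 0<t t<x)))

  sqrt : ∀ {a} → 0# <ʳ a → ∃[ s ] s * s ≈ a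
  sqrt {a} 0<a =
    let s , upper , least = supremum (λ x → x * x ≤ʳ a)
          (0# , λ a<00 → asym 0<a (<-respʳ-≈ (zeroˡ 0#) a<00)) (1# + a , bound)
    in s , supremum-square 0<a upper least
    where
    bound : ∀ x → x * x ≤ʳ a → x ≤ʳ 1# + a
    bound x x²≤a 1+a<x = x²≤a (<-trans
      -- The bound rests on `(1 + a)² = a + (1 + a + a²)`, which exceeds `a`.
      (<-respʳ-≈ (solve 1 (λ a → a :+ (con 1 :+ a :+ a :* a) := (con 1 :+ a) :* (con 1 :+ a)) ≈-refl a)
        (<-+pos a (+-pos (+-pos 0<1 0<a) (*-pos 0<a 0<a))))
      (square-mono (+-pos 0<1 0<a) 1+a<x))

-- Finite sums, matrices and their action on vectors.

module LinearAlgebra {a : Level} (ℝ : RealNumbers a) where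

  open RealNumbers ℝ renaming
    (_<_ to _<ʳ_; _≤_ to _≤ʳ_; refl to ≈-refl; sym to ≈-sym; trans to ≈-trans) hiding (zero)
  open Connection ℝ
  open OrderedField ℝ
  open RingProperties ring
  open SemiringSum semiring
  open IsStrictTotalOrder isStrictTotalOrder using (compare; irrefl; _≟_)
  open SetoidReasoning setoid

  ≋-setoid : ℕ → ℕ → Setoid a a
  ≋-setoid m n = record
    { Carrier = Matrix m n
    ; _≈_ = _≋_
    ; isEquivalence = record
      { refl  = λ _ _ → ≈-refl
      ; sym   = λ A≋B i j → ≈-sym (A≋B i j)
      ; trans = λ A≋B B≋C i j → ≈-trans (A≋B i j) (B≋C i j)
      }
    }

  module _ {m n : ℕ} where
    open Setoid (≋-setoid m n) public using () renaming (refl to ≋-refl; sym to ≋-sym; trans to ≋-trans)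

  module ≋-Reasoning {m n : ℕ} = SetoidReasoning (≋-setoid m n)

  sum-combine : ∀ m {n} (t : Vector Carrier (m ℕ.* n)) →
                sum t ≈ ∑[ i < m ] ∑[ j < n ] t (combine i j)
  sum-combine zero        t = ≈-refl
  sum-combine (suc m) {n} t = ≈-trans (sum-splitAt n t) (+-congˡ (sum-combine m (t ∘ (n ↑ʳ_))))

  sum-nonneg : ∀ {n} (t : Vector Carrier n) → (∀ i → 0# ≤ʳ t i) → 0# ≤ʳ sum t
  sum-nonneg {zero}  t 0≤t = irrefl ≈-refl
  sum-nonneg {suc n} t 0≤t = nonneg-+ (0≤t zero) (sum-nonneg (t ∘ suc) (0≤t ∘ suc))

  sum-nonneg≈0 : ∀ {n} (t : Vector Carrier n) → (∀ i → 0# ≤ʳ t i) → sum t ≈ 0# → ∀ i → t i ≈ 0#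
  sum-nonneg≈0 t 0≤t Σt≈0 zero = nonneg-+≈0 (0≤t zero) (sum-nonneg (t ∘ suc) (0≤t ∘ suc)) Σt≈0
  sum-nonneg≈0 t 0≤t Σt≈0 (suc i) = sum-nonneg≈0 (t ∘ suc) (0≤t ∘ suc)
    (nonneg-+≈0 (sum-nonneg (t ∘ suc) (0≤t ∘ suc)) (0≤t zero) (≈-trans (+-comm _ _) Σt≈0)) i

  square≈0 : ∀ {x} → x * x ≈ 0# → x ≈ 0#
  square≈0 {x} x²≈0 = decidable-stable (x ≟ 0#) λ x≉0 → irrefl (≈-sym x²≈0) (square-pos x≉0)

  -- Positive definiteness of the dot product: no nonnegative summand can be positive when the sum
  -- is zero.
  sum-squares≈0 : ∀ {n} (v : Vector Carrier n) → ∑[ i < n ] (v i * v i) ≈ 0# → ∀ i → v i ≈ 0#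
  sum-squares≈0 v Σ≈0 i = square≈0 (sum-nonneg≈0 (λ i → v i * v i) (λ i → square-nonneg (v i)) Σ≈0 i)

  sum-squares-nonneg : ∀ {n} (v : Vector Carrier n) → 0# ≤ʳ ∑[ i < n ] (v i * v i)
  sum-squares-nonneg v = sum-nonneg (λ i → v i * v i) (λ i → square-nonneg (v i))

  sum-𝕀 : ∀ {n} i (v : Vector Carrier n) → ∑[ k < n ] (𝕀 i k * v k) ≈ v i
  sum-𝕀 {suc n} zero v = ≈-trans
    (+-cong (*-identityˡ (v zero)) (sum-zero {n} (λ k → 0# * v (suc k)) (λ k → zeroˡ (v (suc k)))))
    (+-identityʳ (v zero))
  sum-𝕀 {suc n} (suc i) v = ≈-trans (+-cong (zeroˡ (v zero)) (sum-𝕀 i (v ∘ suc))) (+-identityˡ (v (suc i)))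

  𝕀-sym : ∀ {n} (i j : Fin n) → 𝕀 i j ≈ 𝕀 j i
  𝕀-sym i j with i Fin.≟ j
  ... | yes refl = ≈-sym (𝕀-diag i)
  ... | no  i≢j  = ≈-sym (𝕀-off (i≢j ∘ ≡.sym))

  ·-congˡ : ∀ {m n p} {A : Matrix m n} {B B′ : Matrix n p} → B ≋ B′ → A · B ≋ A · B′
  ·-congˡ B≋ i j = sum-cong-≋ (λ k → *-congˡ (B≋ k j))

  ·-congʳ : ∀ {m n p} {A A′ : Matrix m n} {B : Matrix n p} → A ≋ A′ → A · B ≋ A′ · B
  ·-congʳ A≋ i j = sum-cong-≋ (λ k → *-congʳ (A≋ i k))

  ·-assoc : ∀ {m n p q} (A : Matrix m n) (B : Matrix n p) (C : Matrix p q) → (A · B) · C ≋ A · (B · C)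
  ·-assoc {n = n} {p} A B C i j = begin
    ∑[ k < p ] (∑[ l < n ] (A i l * B l k) * C k j)
      ≈⟨ sum-cong-≋ (λ k → *-distribʳ-sum (C k j) (λ l → A i l * B l k)) ⟩
    ∑[ k < p ] ∑[ l < n ] (A i l * B l k * C k j)
      ≈⟨ ∑-comm (λ k l → A i l * B l k * C k j) ⟩
    ∑[ l < n ] ∑[ k < p ] (A i l * B l k * C k j)
      ≈⟨ sum-cong-≋ (λ l → sum-cong-≋ (λ k → *-assoc (A i l) (B l k) (C k j))) ⟩
    ∑[ l < n ] ∑[ k < p ] (A i l * (B l k * C k j))
      ≈⟨ sum-cong-≋ (λ l → *-distribˡ-sum (A i l) (λ k → B l k * C k j)) ⟨
    ∑[ l < n ] (A i l * ∑[ k < p ] (B l k * C k j)) ∎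

  ·-identityˡ : ∀ {m n} (A : Matrix m n) → 𝕀 · A ≋ A
  ·-identityˡ A i j = sum-𝕀 i (λ k → A k j)

  ·-identityʳ : ∀ {m n} (A : Matrix m n) → A · 𝕀 ≋ A
  ·-identityʳ A i j = ≈-trans (sum-cong-≋ (λ k → ≈-trans (*-comm (A i k) (𝕀 k j)) (*-congʳ (𝕀-sym k j))))
    (sum-𝕀 j (A i))

  ᵀ-· : ∀ {m n p} (A : Matrix m n) (B : Matrix n p) → (A · B) ᵀ ≋ B ᵀ · A ᵀ
  ᵀ-· A B i j = sum-cong-≋ (λ k → *-comm (A j k) (B k i))

  infixr 5 _▷_
  _▷_ : ∀ {m n} → Matrix m n → Vector Carrier n → Vector Carrier m
  _▷_ {n = n} A v i = ∑[ j < n ] (A i j * v j)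

  ▷-congʳ : ∀ {m n} (A : Matrix m n) {u v : Vector Carrier n} → (∀ j → u j ≈ v j) →
            ∀ i → (A ▷ u) i ≈ (A ▷ v) i
  ▷-congʳ A u≈v i = sum-cong-≋ (λ j → *-congˡ (u≈v j))

  ▷-congˡ : ∀ {m n} {A B : Matrix m n} (v : Vector Carrier n) → A ≋ B → ∀ i → (A ▷ v) i ≈ (B ▷ v) i
  ▷-congˡ v A≋B i = sum-cong-≋ (λ j → *-congʳ (A≋B i j))

  ·-▷ : ∀ {m n p} (A : Matrix m n) (B : Matrix n p) (v : Vector Carrier p) →
        ∀ i → (A · B ▷ v) i ≈ (A ▷ B ▷ v) i
  -- The vector is treated as a matrix with one column.
  ·-▷ A B v i = ·-assoc {q = 1} A B (λ k _ → v k) i zero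

  ▷-zero : ∀ {m n} (A : Matrix m n) {v : Vector Carrier n} → (∀ j → v j ≈ 0#) → Kernel A v
  ▷-zero A {v} v≈0 i = sum-zero (λ j → A i j * v j) (λ j → ≈-trans (*-congˡ (v≈0 j)) (zeroʳ (A i j)))

  ▷-sub : ∀ {m n} (A : Matrix m n) (u v : Vector Carrier n) → ∀ i →
          (A ▷ (λ j → u j - v j)) i ≈ (A ▷ u) i - (A ▷ v) i
  ▷-sub {n = n} A u v i = begin
    ∑[ j < n ] (A i j * (u j - v j))
      ≈⟨ sum-cong-≋ (λ j → ≈-trans (distribˡ (A i j) (u j) (- v j)) (+-congˡ (neg j))) ⟩
    ∑[ j < n ] (A i j * u j + - 1# * (A i j * v j))
      ≈⟨ ∑-distrib-+ (λ j → A i j * u j) (λ j → - 1# * (A i j * v j)) ⟩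
    (A ▷ u) i + ∑[ j < n ] (- 1# * (A i j * v j))
      ≈⟨ +-congˡ (*-distribˡ-sum (- 1#) (λ j → A i j * v j)) ⟨
    (A ▷ u) i + - 1# * (A ▷ v) i
      ≈⟨ +-congˡ (-1*x≈-x _) ⟩
    (A ▷ u) i - (A ▷ v) i ∎
    where
    neg : ∀ j → A i j * - v j ≈ - 1# * (A i j * v j)
    neg j = ≈-trans (≈-sym (-‿distribʳ-* (A i j) (v j))) (≈-sym (-1*x≈-x _))

  -- Kernels, elimination and inverses.

  Injective : ∀ {m n} → Pred (Matrix m n) a
  Injective A = ∀ v → Kernel A v → ∀ j → v j ≈ 0#

  -- Each column of the difference of `B` and `C` lies in the kernel of `A`.
  injective-· : ∀ {m n p} (A : Matrix m n) → Injective A → {B C : Matrix n p} → A · B ≋ A · C → B ≋ C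
  injective-· A A-inj {B} {C} AB≋AC i j = x∙y⁻¹≈ε⇒x≈y (B i j) (C i j)
    (A-inj (λ k → B k j - C k j)
           (λ l → ≈-trans (▷-sub A (λ k → B k j) (λ k → C k j) l) (x≈y⇒x∙y⁻¹≈ε (AB≋AC l j))) i)

  NonZeroVector : ∀ {n} → Pred (Vector Carrier n) a
  NonZeroVector v = ∃[ j ] ¬ (v j ≈ 0#)

  -- Gaussian elimination, by induction on the number of rows. A zero first column is killed by the
  -- first unit vector; otherwise a pivot row `p` eliminates the first unknown and is dropped,
  -- leaving one row and one column less.
  wide-kernel : ∀ {m n} → m < n → (M : Matrix m n) → ∃[ v ] (NonZeroVector v × Kernel M v)
  wide-kernel {zero}  {suc n} m<n M = (λ _ → 1#) , (zero , λ 1≈0 → irrefl (≈-sym 1≈0) 0<1) , λ ()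
  wide-kernel {suc m} {suc n} (s≤s m<n) M with Fin.any? (λ i → ¬? (M i zero ≟ 0#))
  ... | no column≈0 = 𝕀 zero , (zero , λ 1≈0 → irrefl (≈-sym 1≈0) 0<1) , λ i →
          ≈-trans (·-identityʳ M i zero) (decidable-stable (M i zero ≟ 0#) λ Mi0≉0 → column≈0 (i , Mi0≉0))
  ... | yes (p , pivot≉0) with z , pz≈1 ← inverse (M p zero) pivot≉0
      = let y , (j , yj≉0) , ker = wide-kernel m<n (λ i → reduced (punchIn p i))
        in x y , (suc j , yj≉0) , λ r → ≈-trans (eliminate y r) (residual y ker r)
    where
    reduced : Matrix (suc m) n
    reduced r j = M r (suc j) + - (M r zero * z) * M p (suc j)

    -- The value of the first unknown that solves equation `p`, where `z` is the reciprocal of the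
    -- pivot.
    head : Vector Carrier n → Carrier
    head y = - (z * ∑[ j < n ] (M p (suc j) * y j))

    x : Vector Carrier n → Vector Carrier (suc n)
    x y zero    = head y
    x y (suc j) = y j

    -- Substituting `head y` for the first unknown amounts to subtracting `M r zero * z` times row
    -- `p` from row `r`.
    eliminate : ∀ y r → (M ▷ x y) r ≈ (reduced ▷ y) r
    eliminate y r = ≈-sym (begin
      ∑[ j < n ] ((M r (suc j) + c * M p (suc j)) * y j)
        ≈⟨ sum-cong-≋ (λ j → ≈-trans (distribʳ (y j) (M r (suc j)) (c * M p (suc j)))
             (+-congˡ (*-assoc c (M p (suc j)) (y j)))) ⟩
      ∑[ j < n ] (M r (suc j) * y j + c * (M p (suc j) * y j))
        ≈⟨ ∑-distrib-+ (λ j → M r (suc j) * y j) (λ j → c * (M p (suc j) * y j)) ⟩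
      ∑[ j < n ] (M r (suc j) * y j) + ∑[ j < n ] (c * (M p (suc j) * y j))
        ≈⟨ +-comm _ _ ⟩
      ∑[ j < n ] (c * (M p (suc j) * y j)) + ∑[ j < n ] (M r (suc j) * y j)
        ≈⟨ +-congʳ (*-distribˡ-sum c (λ j → M p (suc j) * y j)) ⟨
      c * (∑[ j < n ] (M p (suc j) * y j)) + ∑[ j < n ] (M r (suc j) * y j)
        ≈⟨ +-congʳ (≈-trans (≈-sym (-‿distribˡ-* (M r zero * z) _))
             (≈-trans (-‿cong (*-assoc (M r zero) z _)) (-‿distribʳ-* (M r zero) _))) ⟩
      M r zero * head y + ∑[ j < n ] (M r (suc j) * y j) ∎)
      where
      c = - (M r zero * z)

    -- The row `p` left out of the recursion reduces to zero because `M p zero * z ≈ 1#`; every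
    -- other row is a `punchIn`.
    residual : ∀ y → Kernel (λ i → reduced (punchIn p i)) y → Kernel reduced y
    residual y ker r with p Fin.≟ r
    ... | yes refl = sum-zero (λ j → reduced p j * y j) (λ j → ≈-trans (*-congʳ (vanish j)) (zeroˡ (y j)))
      where
      vanish : ∀ j → reduced p j ≈ 0#
      vanish j = ≈-trans (+-congˡ (≈-trans (*-congʳ (-‿cong pz≈1)) (-1*x≈-x _))) (-‿inverseʳ _)
    ... | no p≢r = ≡.subst (λ r → (reduced ▷ y) r ≈ 0#) (Fin.punchIn-punchOut p≢r) (ker (punchOut p≢r))

  -- Prepending the unit vector with index `i` to `A` gives more columns than rows, hence a nonzero
  -- kernel vector. Its leading entry is nonzero, and dividing the tail by minus that entry gives
  -- column `i` of the inverse.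
  injective⇒right-inverse : ∀ {n} (A : Matrix n n) → Injective A → ∃[ B ] A · B ≋ 𝕀
  injective⇒right-inverse {n} A A-inj = (λ j i → B i j) , λ k i → solution i k
    where
    augmented : Fin n → Matrix n (suc n)
    augmented i k zero    = 𝕀 k i
    augmented i k (suc j) = A k j

    solve-column : ∀ i (v : Vector Carrier (suc n)) → NonZeroVector v → Kernel (augmented i) v →
                   ∃[ b ] ∀ k → (A ▷ b) k ≈ 𝕀 k i
    solve-column i v (l , vl≉0) ker =
      let y , v₀y≈1 = inverse (v zero) v₀≉0
      in (λ j → - y * v (suc j)) , λ k → begin
        ∑[ j < n ] (A k j * (- y * v (suc j)))
          ≈⟨ sum-cong-≋ (λ j → swap (A k j) (- y) (v (suc j))) ⟩
        ∑[ j < n ] (- y * (A k j * v (suc j)))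
          ≈⟨ *-distribˡ-sum (- y) (λ j → A k j * v (suc j)) ⟨
        - y * (A ▷ v ∘ suc) k
          ≈⟨ *-congˡ (+-inverseʳ-unique _ _ (ker k)) ⟩
        - y * - (𝕀 k i * v zero)
          ≈⟨ ≈-trans (≈-sym (-‿distribˡ-* y _)) (≈-trans (-‿cong (≈-sym (-‿distribʳ-* y _))) (-‿involutive _)) ⟩
        y * (𝕀 k i * v zero)
          ≈⟨ swap y (𝕀 k i) (v zero) ⟩
        𝕀 k i * (y * v zero)
          ≈⟨ ≈-trans (*-congˡ (≈-trans (*-comm y (v zero)) v₀y≈1)) (*-identityʳ (𝕀 k i)) ⟩
        𝕀 k i ∎
      where
      swap : ∀ x y z → x * (y * z) ≈ y * (x * z)
      swap x y z = ≈-trans (≈-sym (*-assoc x y z)) (≈-trans (*-congʳ (*-comm x y)) (*-assoc y x z))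

      -- With a zero leading entry the tail would lie in the kernel of `A`, so all of `v` would
      -- vanish.
      v₀≉0 : ¬ (v zero ≈ 0#)
      v₀≉0 v₀≈0 = vl≉0 (v≈0 l)
        where
        tail≈0 : ∀ j → v (suc j) ≈ 0#
        tail≈0 = A-inj (v ∘ suc) λ k → ≈-trans (≈-sym (+-identityˡ _))
          (≈-trans (+-congʳ (≈-sym (≈-trans (*-congˡ v₀≈0) (zeroʳ (𝕀 k i))))) (ker k))

        v≈0 : ∀ l → v l ≈ 0#
        v≈0 zero    = v₀≈0
        v≈0 (suc j) = tail≈0 j

    column : ∀ i → ∃[ b ] ∀ k → (A ▷ b) k ≈ 𝕀 k i
    column i = let v , v≉0 , ker = wide-kernel (ℕ.n<1+n n) (augmented i) in solve-column i v v≉0 ker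

    B = λ i → proj₁ (column i)
    solution = λ i → proj₂ (column i)

  -- From `A · B ≋ 𝕀` follows `A · (B · A) ≋ A · 𝕀`, and an injective `A` cancels on the left.
  injective⇒invertible : ∀ {n} (A : Matrix n n) → Injective A → Invertible A
  injective⇒invertible A A-inj =
    let B , AB≋𝕀 = injective⇒right-inverse A A-inj
    in B , AB≋𝕀 , injective-· A A-inj
         (≋-trans (≋-sym (·-assoc A B A))
           (≋-trans (·-congʳ AB≋𝕀) (≋-trans (·-identityˡ A) (≋-sym (·-identityʳ A)))))

  left-inverse⇒injective : ∀ {m n} (A : Matrix m n) (B : Matrix n m) → B · A ≋ 𝕀 → Injective A
  left-inverse⇒injective A B BA≋𝕀 v Av≈0 j = begin
    v j            ≈⟨ sum-𝕀 j v ⟨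
    (𝕀 ▷ v) j      ≈⟨ ▷-congˡ v BA≋𝕀 j ⟨
    (B · A ▷ v) j  ≈⟨ ·-▷ B A v j ⟩
    (B ▷ A ▷ v) j  ≈⟨ ▷-zero B Av≈0 j ⟩
    0#             ∎

  -- The transpose is a left inverse, so `A` is injective and has an inverse `B`; multiplying
  -- `A ᵀ · A ≋ 𝕀` by `B` identifies `B` with `A ᵀ`.
  orthonormal-columns⇒orthogonal : ∀ {n} (A : Matrix n n) → A ᵀ · A ≋ 𝕀 → Orthogonal A
  orthonormal-columns⇒orthogonal A AᵀA≋𝕀 =
    let B , AB≋𝕀 , _ = injective⇒invertible A (left-inverse⇒injective A (A ᵀ) AᵀA≋𝕀)
        B≋Aᵀ : B ≋ A ᵀ
        B≋Aᵀ = ≋-trans (≋-sym (·-identityˡ B)) (≋-trans (·-congʳ (≋-sym AᵀA≋𝕀))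
                 (≋-trans (·-assoc (A ᵀ) A B) (≋-trans (·-congˡ AB≋𝕀) (·-identityʳ (A ᵀ)))))
    in ≋-trans (·-congˡ (≋-sym B≋Aᵀ)) AB≋𝕀 , AᵀA≋𝕀

  -- Gram-Schmidt orthonormalisation inside a column space.

  infix 4 _⊥_
  _⊥_ : ∀ {d m n} → Matrix d m → Matrix d n → Set a
  A ⊥ B = ∀ i j → (A ᵀ · B) i j ≈ 0#

  consColumn : ∀ {m k} → Vector Carrier m → Matrix m k → Matrix m (suc k)
  consColumn c C j zero    = c j
  consColumn c C j (suc l) = C j l

  normalise : ∀ {d} (u : Vector Carrier d) → NonZeroVector u →
              ∃[ t ] ∑[ x < d ] (u x * t * (u x * t)) ≈ 1#
  normalise {d} u (x₀ , ux₀≉0) =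
    -- Here `s` is a square root of the squared length of `u`, and the factor `t` is its reciprocal.
    let s , s²≈N = sqrt 0<N
        t , st≈1 = inverse s λ s≈0 → irrefl
          (≈-sym (≈-trans (≈-sym s²≈N) (≈-trans (*-congʳ s≈0) (zeroˡ s)))) 0<N
    in t , (begin
      ∑[ x < d ] (u x * t * (u x * t))
        ≈⟨ sum-cong-≋ (λ x → square-* (u x) t) ⟩
      ∑[ x < d ] (u x * u x * (t * t))
        ≈⟨ *-distribʳ-sum (t * t) (λ x → u x * u x) ⟨
      ∑[ x < d ] (u x * u x) * (t * t)
        ≈⟨ *-congʳ s²≈N ⟨
      s * s * (t * t)
        ≈⟨ square-* s t ⟨
      s * t * (s * t)
        ≈⟨ *-cong st≈1 st≈1 ⟩
      1# * 1#
        ≈⟨ *-identityˡ 1# ⟩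
      1# ∎)
    where
    square-* : ∀ x y → x * y * (x * y) ≈ x * x * (y * y)
    square-* x y = ≈-trans (*-assoc x y (x * y)) (≈-trans (*-congˡ (≈-trans (≈-sym (*-assoc y x y))
      (≈-trans (*-congʳ (*-comm y x)) (*-assoc x y y)))) (≈-sym (*-assoc x x (y * y))))

    0<N : 0# <ʳ ∑[ x < d ] (u x * u x)
    0<N with compare 0# (∑[ x < d ] (u x * u x))
    ... | tri< 0<N _ _ = 0<N
    ... | tri≈ _ 0≈N _ = contradiction (sum-squares≈0 u (≈-sym 0≈N) x₀) ux₀≉0
    ... | tri> _ _ N<0 = contradiction N<0 (sum-squares-nonneg u)

  -- The columns of `C` are coefficients, so the orthonormal vectors `B · C` remain in the column
  -- space of `B`, while `K` collects vectors they must avoid.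
  OrthonormalIn : ∀ {d m p} → Matrix d m → Matrix d p → ∀ {k} → Matrix m k → Set a
  OrthonormalIn B K C = (B · C) ᵀ · (B · C) ≋ 𝕀 × K ⊥ B · C

  -- No projection is computed. Orthogonality to `K` and to the vectors already found is `p + k`
  -- linear equations in `m` unknowns, so a nonzero solution exists; its image under the injective
  -- `B` is nonzero and can be normalised.
  gram-schmidt-step : ∀ {d m p k} (B : Matrix d m) → Injective B → (K : Matrix d p) → p ℕ.+ k < m →
                      (C : Matrix m k) → OrthonormalIn B K C →
                      ∃[ c ] OrthonormalIn B K (consColumn c C)
  gram-schmidt-step {d} {m} {p} {k} B B-inj K p+k<m C (orthonormal , K⊥BC) =
    let c , c≉0 , ker = wide-kernel p+k<m M
        t , norm = normalise (B ▷ c) (image≉0 c c≉0)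
    in (λ j → c j * t) , extend c t norm (K⊥ c ker) (BC⊥ c ker)
    where
    M : Matrix (p ℕ.+ k) m
    M x j = [ (λ i → (K ᵀ · B) i j) , (λ l → ((B · C) ᵀ · B) l j) ]′ (splitAt p x)

    image≉0 : ∀ c → NonZeroVector c → NonZeroVector (B ▷ c)
    image≉0 c (j , cj≉0) with Fin.any? (λ x → ¬? ((B ▷ c) x ≟ 0#))
    ... | yes Bc≉0 = Bc≉0
    ... | no  Bc≈0 = contradiction
            (B-inj c (λ x → decidable-stable ((B ▷ c) x ≟ 0#) λ Bcx≉0 → Bc≈0 (x , Bcx≉0)) j) cj≉0

    K⊥ : ∀ c → Kernel M c → Kernel (K ᵀ) (B ▷ c)
    K⊥ c ker i = ≈-trans (≈-sym (·-▷ (K ᵀ) B c i))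
      (≡.subst (λ z → ∑[ j < m ] ([ (λ i → (K ᵀ · B) i j) , (λ l → ((B · C) ᵀ · B) l j) ]′ z * c j) ≈ 0#)
        (Fin.splitAt-↑ˡ p i k) (ker (i ↑ˡ k)))

    BC⊥ : ∀ c → Kernel M c → Kernel ((B · C) ᵀ) (B ▷ c)
    BC⊥ c ker l = ≈-trans (≈-sym (·-▷ ((B · C) ᵀ) B c l))
      (≡.subst (λ z → ∑[ j < m ] ([ (λ i → (K ᵀ · B) i j) , (λ l → ((B · C) ᵀ · B) l j) ]′ z * c j) ≈ 0#)
        (Fin.splitAt-↑ʳ p k l) (ker (p ↑ʳ l)))

    extend : ∀ c t → ∑[ x < d ] ((B ▷ c) x * t * ((B ▷ c) x * t)) ≈ 1# →
             Kernel (K ᵀ) (B ▷ c) → Kernel ((B · C) ᵀ) (B ▷ c) →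
             OrthonormalIn B K (consColumn (λ j → c j * t) C)
    extend c t norm K⊥Bc BC⊥Bc = gram , perp
      where
      new : ∀ x → (B ▷ (λ j → c j * t)) x ≈ (B ▷ c) x * t
      new x = ≈-trans (sum-cong-≋ (λ j → ≈-sym (*-assoc (B x j) (c j) t)))
                      (≈-sym (*-distribʳ-sum t (λ j → B x j * c j)))

      ⊥-new : ∀ {q} (A : Matrix d q) → Kernel (A ᵀ) (B ▷ c) → Kernel (A ᵀ) (B ▷ (λ j → c j * t))
      ⊥-new A A⊥Bc i = begin
        (A ᵀ ▷ B ▷ (λ j → c j * t)) i      ≈⟨ ▷-congʳ (A ᵀ) new i ⟩
        (A ᵀ ▷ (λ x → (B ▷ c) x * t)) i    ≈⟨ sum-cong-≋ (λ x → ≈-sym (*-assoc (A x i) ((B ▷ c) x) t)) ⟩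
        ∑[ x < d ] (A x i * (B ▷ c) x * t) ≈⟨ *-distribʳ-sum t (λ x → A x i * (B ▷ c) x) ⟨
        (A ᵀ ▷ B ▷ c) i * t                ≈⟨ *-congʳ (A⊥Bc i) ⟩
        0# * t                             ≈⟨ zeroˡ t ⟩
        0#                                 ∎

      gram : (B · consColumn (λ j → c j * t) C) ᵀ · (B · consColumn (λ j → c j * t) C) ≋ 𝕀
      gram zero    zero     = ≈-trans (sum-cong-≋ (λ x → *-cong (new x) (new x))) norm
      gram zero    (suc l)  = ≈-trans (sum-cong-≋ (λ x → *-comm _ ((B · C) x l))) (⊥-new (B · C) BC⊥Bc l)
      gram (suc l) zero     = ⊥-new (B · C) BC⊥Bc l
      gram (suc l) (suc l′) = orthonormal l l′

      perp : K ⊥ B · consColumn (λ j → c j * t) C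
      perp i zero    = ⊥-new K K⊥Bc i
      perp i (suc l) = K⊥BC i l

  gram-schmidt : ∀ {d m p} (B : Matrix d m) → Injective B → (K : Matrix d p) →
                 ∀ k → p ℕ.+ k ℕ.≤ m → Σ[ C ∈ Matrix m k ] OrthonormalIn B K C
  gram-schmidt B B-inj K zero    p≤m = (λ _ ()) , (λ ()) , (λ _ ())
  gram-schmidt {p = p} B B-inj K (suc k) p+1+k≤m =
    let p+k<m = ℕ.≤-trans (ℕ.≤-reflexive (≡.sym (ℕ.+-suc p k))) p+1+k≤m
        C , C-ok = gram-schmidt B B-inj K k (<⇒≤ p+k<m)
        c , c-ok = gram-schmidt-step B B-inj K p+k<m C C-ok
    in consColumn c C , c-ok

-- Rows of the connection Laplacian as sums over edges.

module LaplacianKernel {a : Level} (ℝ : RealNumbers a) {n : ℕ} (G : Connection.WeightedGraph ℝ n) where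

  open RealNumbers ℝ renaming
    (_<_ to _<ʳ_; _≤_ to _≤ʳ_; refl to ≈-refl; sym to ≈-sym; trans to ≈-trans) hiding (zero)
  open Connection ℝ
  open OrderedField ℝ
  open LinearAlgebra ℝ
  open RingProperties ring
  open SemiringSum semiring
  open IsStrictTotalOrder isStrictTotalOrder using (irrefl)
  open SetoidReasoning setoid
  open WeightedGraph G
  open Signature

  blocks : ∀ {d} → Vector Carrier (n ℕ.* d) → Fin n → Vector Carrier d
  blocks v i x = v (combine i x)

  -- These are the parallel sections of the connection given by the signature.
  Flat : ∀ {d} → Signature G d → (Fin n → Vector Carrier d) → Set a
  Flat s u = ∀ {i j} (e : i ∼ j) x → u i x ≈ (σ s e ▷ u j) x

  -- The contribution of `j` to row block `i` of the Laplacian once `deg i` is distributed over the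
  -- neighbours. The value zero off the edges lets sums run over all vertices.
  edgeTerm : ∀ {d} → Signature G d → (Fin n → Vector Carrier d) → Fin n → Fin n → Vector Carrier d
  edgeTerm s u i j x with i ∼? j
  ... | yes e = w i j * (u i x - (σ s e ▷ u j) x)
  ... | no  _ = 0#

  edgeTerm-∼ : ∀ {d} (s : Signature G d) u {i j} (e : i ∼ j) x →
               edgeTerm s u i j x ≈ w i j * (u i x - (σ s e ▷ u j) x)
  edgeTerm-∼ s u {i} {j} e x with i ∼? j
  -- The decision may return a different proof of adjacency, and irrelevance identifies it with `e`.
  ... | yes e′ = reflexive (cong (λ e → w i j * (u i x - (σ s e ▷ u j) x)) (∼-irrelevant e′ e))
  ... | no  ¬e = contradiction e ¬e

  edgeTerm-≁ : ∀ {d} (s : Signature G d) u {i j} → ¬ (i ∼ j) → ∀ x → edgeTerm s u i j x ≈ 0#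
  edgeTerm-≁ s u {i} {j} ¬e x with i ∼? j
  ... | yes e = contradiction e ¬e
  ... | no  _ = ≈-refl

  -- Moving the part of deg i that comes from j to the other side avoids subtraction.
  laplacianBlock-▷ : ∀ {d} (s : Signature G d) u i j x →
    (laplacianBlock s i j ▷ u j) x + (if does (i ∼? j) then w i j else 0#) * u i x ≈
    𝕀 i j * (deg i * u i x) + edgeTerm s u i j x
  laplacianBlock-▷ {d} s u i j x with i Fin.≟ j | i ∼? j
  ... | yes refl | yes e = contradiction e ∼-irrefl
  ... | yes refl | no _ = +-cong diagonal (zeroˡ (u i x))
    where
    diagonal : ∑[ y < d ] (deg i * 𝕀 x y * u i y) ≈ 1# * (deg i * u i x)
    diagonal = begin
      ∑[ y < d ] (deg i * 𝕀 x y * u i y)    ≈⟨ sum-cong-≋ (λ y → *-assoc (deg i) (𝕀 x y) (u i y)) ⟩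
      ∑[ y < d ] (deg i * (𝕀 x y * u i y))  ≈⟨ *-distribˡ-sum (deg i) (λ y → 𝕀 x y * u i y) ⟨
      deg i * ∑[ y < d ] (𝕀 x y * u i y)    ≈⟨ *-congˡ (sum-𝕀 x (u i)) ⟩
      deg i * u i x                         ≈⟨ *-identityˡ _ ⟨
      1# * (deg i * u i x)                  ∎
  ... | no _ | yes e = begin
    ∑[ y < d ] (- w i j * σ s e x y * u j y) + w i j * u i x
      ≈⟨ +-congʳ (sum-cong-≋ (λ y → *-assoc (- w i j) (σ s e x y) (u j y))) ⟩
    ∑[ y < d ] (- w i j * (σ s e x y * u j y)) + w i j * u i x
      ≈⟨ +-congʳ (*-distribˡ-sum (- w i j) (λ y → σ s e x y * u j y)) ⟨
    - w i j * (σ s e ▷ u j) x + w i j * u i x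
      ≈⟨ +-comm _ _ ⟩
    w i j * u i x + - w i j * (σ s e ▷ u j) x
      ≈⟨ +-congˡ (≈-trans (≈-sym (-‿distribˡ-* (w i j) _)) (-‿distribʳ-* (w i j) _)) ⟩
    w i j * u i x + w i j * - (σ s e ▷ u j) x
      ≈⟨ distribˡ (w i j) (u i x) _ ⟨
    w i j * (u i x - (σ s e ▷ u j) x)
      ≈⟨ ≈-trans (+-congʳ (zeroˡ _)) (+-identityˡ _) ⟨
    0# * (deg i * u i x) + w i j * (u i x - (σ s e ▷ u j) x) ∎
  ... | no _ | no _ = +-cong
          (≈-trans (sum-zero (λ y → 0# * u j y) (λ y → zeroˡ (u j y))) (≈-sym (zeroˡ _))) (zeroˡ (u i x))

  -- Summing the block identity over `j` puts `deg i * u i x` on both sides, where it cancels.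
  laplacianBlock-row : ∀ {d} (s : Signature G d) u i x →
    ∑[ j < n ] (laplacianBlock s i j ▷ u j) x ≈ ∑[ j < n ] edgeTerm s u i j x
  laplacianBlock-row s u i x = +-cancelʳ (deg i * u i x) _ _ (begin
    ∑[ j < n ] (laplacianBlock s i j ▷ u j) x + deg i * u i x
      ≈⟨ +-congˡ (*-distribʳ-sum (u i x) degreeTerm) ⟩
    ∑[ j < n ] (laplacianBlock s i j ▷ u j) x + ∑[ j < n ] (degreeTerm j * u i x)
      ≈⟨ ∑-distrib-+ (λ j → (laplacianBlock s i j ▷ u j) x) (λ j → degreeTerm j * u i x) ⟨
    ∑[ j < n ] ((laplacianBlock s i j ▷ u j) x + degreeTerm j * u i x)
      ≈⟨ sum-cong-≋ (λ j → laplacianBlock-▷ s u i j x) ⟩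
    ∑[ j < n ] (𝕀 i j * (deg i * u i x) + edgeTerm s u i j x)
      ≈⟨ ∑-distrib-+ (λ j → 𝕀 i j * (deg i * u i x)) (λ j → edgeTerm s u i j x) ⟩
    ∑[ j < n ] (𝕀 i j * (deg i * u i x)) + ∑[ j < n ] edgeTerm s u i j x
      ≈⟨ +-congʳ (sum-𝕀 i (λ _ → deg i * u i x)) ⟩
    deg i * u i x + ∑[ j < n ] edgeTerm s u i j x
      ≈⟨ +-comm _ _ ⟩
    ∑[ j < n ] edgeTerm s u i j x + deg i * u i x ∎)
    where
    degreeTerm : Fin n → Carrier
    degreeTerm j = if does (i ∼? j) then w i j else 0#

  laplacian-row : ∀ {d} (s : Signature G d) v k →
    (laplacian s ▷ v) k ≈ ∑[ j < n ] edgeTerm s (blocks v) (quotient d k) j (remainder {n} d k)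
  laplacian-row {d} s v k = begin
    (laplacian s ▷ v) k
      ≈⟨ sum-combine n (λ l → laplacian s k l * v l) ⟩
    ∑[ j < n ] ∑[ y < d ] (laplacian s k (combine j y) * v (combine j y))
      ≈⟨ sum-cong-≋ (λ j → sum-cong-≋ (λ y → *-congʳ (reflexive
           (cong (λ q → laplacianBlock s (quotient d k) (proj₁ q) (remainder {n} d k) (proj₂ q))
                 (Fin.remQuot-combine j y))))) ⟩
    ∑[ j < n ] (laplacianBlock s (quotient d k) j ▷ blocks v j) (remainder {n} d k)
      ≈⟨ laplacianBlock-row s (blocks v) (quotient d k) (remainder {n} d k) ⟩
    ∑[ j < n ] edgeTerm s (blocks v) (quotient d k) j (remainder {n} d k) ∎

  flat⇒kernel : ∀ {d} (s : Signature G d) v → Flat s (blocks v) → Kernel (laplacian s) v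
  flat⇒kernel {d} s v flat k = ≈-trans (laplacian-row s v k)
    (sum-zero (λ j → edgeTerm s (blocks v) (quotient d k) j (remainder {n} d k)) vanish)
    where
    vanish : ∀ j → edgeTerm s (blocks v) (quotient d k) j (remainder {n} d k) ≈ 0#
    vanish j with quotient {n} d k ∼? j
    ... | yes e = ≈-trans (*-congˡ (x≈y⇒x∙y⁻¹≈ε (flat e (remainder {n} d k)))) (zeroʳ _)
    ... | no  _ = ≈-refl

  -- The quadratic form and flatness of kernel vectors.

  ⟨_,_⟩ : ∀ {d} → Vector Carrier d → Vector Carrier d → Carrier
  ⟨_,_⟩ {d} u v = ∑[ x < d ] (u x * v x)

  ⟨⟩-sub : ∀ {d} (t u v : Vector Carrier d) → ⟨ t , (λ x → u x - v x) ⟩ ≈ ⟨ t , u ⟩ - ⟨ t , v ⟩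
  ⟨⟩-sub t u v = ▷-sub {m = 1} (λ _ → t) u v zero

  ⟨⟩-scaleˡ : ∀ {d} c (u v : Vector Carrier d) → ⟨ (λ x → c * u x) , v ⟩ ≈ c * ⟨ u , v ⟩
  ⟨⟩-scaleˡ c u v = ≈-trans (sum-cong-≋ (λ x → *-assoc c (u x) (v x)))
                            (≈-sym (*-distribˡ-sum c (λ x → u x * v x)))

  ⟨⟩-adjoint : ∀ {m d} (A : Matrix m d) u v → ⟨ A ᵀ ▷ u , v ⟩ ≈ ⟨ u , A ▷ v ⟩
  ⟨⟩-adjoint A u v = ≈-trans
    (sum-cong-≋ (λ x → *-congʳ {v x} (sum-cong-≋ (λ y → *-comm (A y x) (u y)))))
    (·-▷ {m = 1} (λ _ → u) A v zero)

  module _ {d : ℕ} (s : Signature G d) (u : Fin n → Vector Carrier d)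
           (rows≈0 : ∀ i x → ∑[ j < n ] edgeTerm s u i j x ≈ 0#) where

    private
      -- The share of an ordered pair in the quadratic form of the Laplacian. It has no definite
      -- sign until the two orientations are added.
      energy : Fin n → Fin n → Carrier
      energy i j = ⟨ edgeTerm s u i j , u i ⟩

      Σenergy≈0 : ∑[ i < n ] ∑[ j < n ] energy i j ≈ 0#
      Σenergy≈0 = sum-zero (λ i → ∑[ j < n ] energy i j) λ i → begin
        ∑[ j < n ] ∑[ x < d ] (edgeTerm s u i j x * u i x)
          ≈⟨ ∑-comm (λ j x → edgeTerm s u i j x * u i x) ⟩
        ∑[ x < d ] ∑[ j < n ] (edgeTerm s u i j x * u i x)
          ≈⟨ sum-zero (λ x → ∑[ j < n ] (edgeTerm s u i j x * u i x)) (λ x →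
               ≈-trans (≈-sym (*-distribʳ-sum (u i x) (λ j → edgeTerm s u i j x)))
                 (≈-trans (*-congʳ (rows≈0 i x)) (zeroˡ (u i x)))) ⟩
        0# ∎

      defect : ∀ {i j} → i ∼ j → Vector Carrier d
      defect {i} {j} e x = u i x - (σ s e ▷ u j) x

      -- Writing `u j` as `σᵀ σ u j` shows that the defect of the reversed edge is minus `σᵀ`
      -- applied to the defect of `e`.
      backwards : ∀ {i j} (e : i ∼ j) x → edgeTerm s u j i x ≈ w i j * - 1# * (σ s e ᵀ ▷ defect e) x
      backwards {i} {j} e x = begin
        edgeTerm s u j i x
          ≈⟨ edgeTerm-∼ s u (∼-sym e) x ⟩
        w j i * (u j x - (σ s (∼-sym e) ▷ u i) x)
          ≈⟨ *-cong (w-sym j i) (+-cong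
               (≈-trans (≈-sym (sum-𝕀 x (u j))) (≈-sym (▷-congˡ (u j) (proj₂ (orthogonal s e)) x)))
               (-‿cong (▷-congˡ (u i) (reversal s e) x))) ⟩
        w i j * ((σ s e ᵀ · σ s e ▷ u j) x - (σ s e ᵀ ▷ u i) x)
          ≈⟨ *-congˡ (+-congʳ (·-▷ (σ s e ᵀ) (σ s e) (u j) x)) ⟩
        w i j * ((σ s e ᵀ ▷ σ s e ▷ u j) x - (σ s e ᵀ ▷ u i) x)
          ≈⟨ *-congˡ (⁻¹-anti-homo‿- _ _) ⟨
        w i j * - ((σ s e ᵀ ▷ u i) x - (σ s e ᵀ ▷ σ s e ▷ u j) x)
          ≈⟨ *-congˡ (-‿cong (▷-sub (σ s e ᵀ) (u i) (σ s e ▷ u j) x)) ⟨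
        w i j * - (σ s e ᵀ ▷ defect e) x
          ≈⟨ *-congˡ (-1*x≈-x _) ⟨
        w i j * (- 1# * (σ s e ᵀ ▷ defect e) x)
          ≈⟨ *-assoc _ _ _ ⟨
        w i j * - 1# * (σ s e ᵀ ▷ defect e) x ∎

      -- Moving `σᵀ` across the inner product merges the two orientations into the defect paired
      -- with `u i` minus `σ u j`, which is the defect itself.
      symmetrised : ∀ {i j} (e : i ∼ j) → energy i j + energy j i ≈ w i j * ⟨ defect e , defect e ⟩
      symmetrised {i} {j} e = begin
        energy i j + energy j i
          ≈⟨ +-cong (sum-cong-≋ (λ x → *-congʳ (edgeTerm-∼ s u e x)))
                    (sum-cong-≋ (λ x → *-congʳ (backwards e x))) ⟩
        ⟨ (λ x → w i j * defect e x) , u i ⟩ + ⟨ (λ x → w i j * - 1# * (σ s e ᵀ ▷ defect e) x) , u j ⟩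
          ≈⟨ +-cong (⟨⟩-scaleˡ (w i j) (defect e) (u i))
                    (⟨⟩-scaleˡ (w i j * - 1#) (σ s e ᵀ ▷ defect e) (u j)) ⟩
        w i j * ⟨ defect e , u i ⟩ + w i j * - 1# * ⟨ σ s e ᵀ ▷ defect e , u j ⟩
          ≈⟨ +-congˡ (≈-trans (*-assoc (w i j) (- 1#) _) (*-congˡ (-1*x≈-x _))) ⟩
        w i j * ⟨ defect e , u i ⟩ + w i j * - ⟨ σ s e ᵀ ▷ defect e , u j ⟩
          ≈⟨ distribˡ (w i j) _ _ ⟨
        w i j * (⟨ defect e , u i ⟩ - ⟨ σ s e ᵀ ▷ defect e , u j ⟩)
          ≈⟨ *-congˡ (+-congˡ (-‿cong (⟨⟩-adjoint (σ s e) (defect e) (u j)))) ⟩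
        w i j * (⟨ defect e , u i ⟩ - ⟨ defect e , σ s e ▷ u j ⟩)
          ≈⟨ *-congˡ (⟨⟩-sub (defect e) (u i) (σ s e ▷ u j)) ⟨
        w i j * ⟨ defect e , defect e ⟩ ∎

      0<w : ∀ {i j} → i ∼ j → 0# <ʳ w i j
      0<w {i} {j} e = Equivalence.from (w-pos i j) e

      energy-≁ : ∀ {i j} → ¬ (i ∼ j) → energy i j ≈ 0#
      energy-≁ {i} {j} ¬e = sum-zero (λ x → edgeTerm s u i j x * u i x)
        (λ x → ≈-trans (*-congʳ (edgeTerm-≁ s u ¬e x)) (zeroˡ (u i x)))

      symmetrised-nonneg : ∀ i j → 0# ≤ʳ energy i j + energy j i
      symmetrised-nonneg i j = byCases (i ∼? j)
        where
        byCases : Dec (i ∼ j) → 0# ≤ʳ energy i j + energy j i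
        byCases (yes e) = nonneg-resp
          (≈-sym (symmetrised e)) (pos-nonneg-* (0<w e) (sum-squares-nonneg (defect e)))
        byCases (no ¬e) = nonneg-resp
          (≈-sym (≈-trans (+-cong (energy-≁ ¬e) (energy-≁ (¬e ∘ ∼-sym))) (+-identityˡ 0#))) (irrefl ≈-refl)

      Σsymmetrised≈0 : ∑[ i < n ] ∑[ j < n ] (energy i j + energy j i) ≈ 0#
      Σsymmetrised≈0 = begin
        ∑[ i < n ] ∑[ j < n ] (energy i j + energy j i)
          ≈⟨ sum-cong-≋ (λ i → ∑-distrib-+ (λ j → energy i j) (λ j → energy j i)) ⟩
        ∑[ i < n ] (∑[ j < n ] energy i j + ∑[ j < n ] energy j i)
          ≈⟨ ∑-distrib-+ (λ i → ∑[ j < n ] energy i j) (λ i → ∑[ j < n ] energy j i) ⟩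
        ∑[ i < n ] ∑[ j < n ] energy i j + ∑[ i < n ] ∑[ j < n ] energy j i
          ≈⟨ +-cong Σenergy≈0 (≈-trans (∑-comm (λ i j → energy j i)) Σenergy≈0) ⟩
        0# + 0#
          ≈⟨ +-identityˡ 0# ⟩
        0# ∎

    -- A vanishing sum of nonnegative terms has vanishing terms, and a positive weight then forces
    -- the defect of each edge to be zero.
    rows≈0⇒flat : Flat s u
    rows≈0⇒flat {i} {j} e x = x∙y⁻¹≈ε⇒x≈y _ _ (sum-squares≈0 (defect e)
      (*-integral (λ w≈0 → irrefl (≈-sym w≈0) (0<w e)) (≈-trans (≈-sym (symmetrised e)) energy≈0)) x)
      where
      energy≈0 : energy i j + energy j i ≈ 0#
      energy≈0 = sum-nonneg≈0 (λ j → energy i j + energy j i) (symmetrised-nonneg i)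
        (sum-nonneg≈0 (λ i → ∑[ j < n ] (energy i j + energy j i))
          (λ i → sum-nonneg (λ j → energy i j + energy j i) (symmetrised-nonneg i)) Σsymmetrised≈0 i) j

  kernel⇒flat : ∀ {d} (s : Signature G d) v → Kernel (laplacian s) v → Flat s (blocks v)
  kernel⇒flat s v ker = rows≈0⇒flat s (blocks v) λ i x →
    ≡.subst (λ q → ∑[ j < n ] edgeTerm s (blocks v) (proj₁ q) j (proj₂ q) ≈ 0#)
      (Fin.remQuot-combine i x) (≈-trans (≈-sym (laplacian-row s v (combine i x))) (ker (combine i x)))

-- Parallel transport along walks.

module Transport {a : Level} (ℝ : RealNumbers a) {n : ℕ} (G : Connection.WeightedGraph ℝ n) where

  open RealNumbers ℝ renaming
    (_<_ to _<ʳ_; _≤_ to _≤ʳ_; refl to ≈-refl; sym to ≈-sym; trans to ≈-trans) hiding (zero)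
  open Connection ℝ
  open LinearAlgebra ℝ
  open LaplacianKernel ℝ G
  open SemiringSum semiring
  private module ≈-Reasoning = SetoidReasoning setoid
  open WeightedGraph G
  open Signature

  -- Each column is a flat family, so `k` of them are transported by a single matrix product.
  FlatFrame : ∀ {d k} → Signature G d → (Fin n → Matrix d k) → Set a
  FlatFrame s K = ∀ {i j} (e : i ∼ j) → K i ≋ σ s e · K j

  transport : ∀ {d k} (s : Signature G d) (K : Fin n → Matrix d k) → FlatFrame s K →
              ∀ {i j} (p : Star _∼_ i j) → K i ≋ walkProduct s p · K j
  transport s K flat ε       = ≋-sym (·-identityˡ _)
  transport s K flat (e ◅ p) = ≋-trans (flat e)
    (≋-trans (·-congˡ (transport s K flat p)) (≋-sym (·-assoc (σ s e) (walkProduct s p) _)))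

  -- An isometry preserves inner products, here between all columns of `B` and `C` at once.
  gram-cancel : ∀ {d m k l} (A : Matrix m d) (B : Matrix d k) (C : Matrix d l) →
                A ᵀ · A ≋ 𝕀 → (A · B) ᵀ · (A · C) ≋ B ᵀ · C
  gram-cancel A B C AᵀA≋𝕀 =
    ≋-trans (·-congʳ (ᵀ-· A B)) $
    ≋-trans (·-assoc (B ᵀ) (A ᵀ) (A · C)) $
    ·-congˡ (≋-trans (≋-sym (·-assoc (A ᵀ) A C)) (≋-trans (·-congʳ AᵀA≋𝕀) (·-identityˡ C)))

  walkProduct-isometry : ∀ {d} (s : Signature G d) {i j} (p : Star _∼_ i j) →
                         walkProduct s p ᵀ · walkProduct s p ≋ 𝕀
  walkProduct-isometry s ε       = ≋-trans (·-congʳ 𝕀-sym′) (·-identityˡ 𝕀)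
    where
    𝕀-sym′ : 𝕀 ᵀ ≋ 𝕀
    𝕀-sym′ i j = 𝕀-sym j i
  walkProduct-isometry s (e ◅ p) = ≋-trans
    (gram-cancel (σ s e) (walkProduct s p) (walkProduct s p) (proj₂ (orthogonal s e)))
    (walkProduct-isometry s p)

  -- Values of a kernel basis at each vertex, and the bound on the nullity.

  module KernelFrame (connected : Connected) {d ρ : ℕ} (s : Signature G d)
                     (nullity : HasNullity (laplacian s) ρ) where

    private
      b = proj₁ nullity
      open IsBasis (proj₂ nullity)

    kernelFrame : Fin n → Matrix d ρ
    kernelFrame i x l = b l (combine i x)

    kernelFrame-flat : FlatFrame s kernelFrame
    kernelFrame-flat e x l = kernel⇒flat s (b l) (members l) e x

    -- A combination vanishing at `i` is transported to zero at every vertex, so it is a vanishing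
    -- combination of basis vectors.
    kernelFrame-injective : ∀ i → Injective (kernelFrame i)
    kernelFrame-injective i c Kᵢc≈0 = independent c λ k →
      ≡.subst (λ k → combination c b k ≈ 0#) (Fin.combine-remQuot {n} d k)
        (≈-trans (sum-cong-≋ (λ l → *-comm (c l) _)) (everywhere (quotient d k) (remainder {n} d k)))
      where
      open ≈-Reasoning

      everywhere : ∀ j → Kernel (kernelFrame j) c
      everywhere j x = begin
        (kernelFrame j ▷ c) x
          ≈⟨ ▷-congˡ c (transport s kernelFrame kernelFrame-flat (connected j i)) x ⟩
        (walkProduct s (connected j i) · kernelFrame i ▷ c) x
          ≈⟨ ·-▷ (walkProduct s (connected j i)) (kernelFrame i) c x ⟩
        (walkProduct s (connected j i) ▷ kernelFrame i ▷ c) x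
          ≈⟨ ▷-zero (walkProduct s (connected j i)) Kᵢc≈0 x ⟩
        0# ∎

    -- A flat family, read as one long vector, lies in the kernel; its coefficients `c` serve at all
    -- vertices simultaneously.
    kernelFrame-spanning : (u : Fin n → Vector Carrier d) → Flat s u →
                           ∃[ c ] ∀ i x → u i x ≈ (kernelFrame i ▷ c) x
    kernelFrame-spanning u u-flat =
      let c , v≈ = spanning v (flat⇒kernel s v blocks-flat)
      in c , λ i x → ≈-trans (reflexive (≡.sym (blocks-v i x)))
           (≈-trans (v≈ (combine i x)) (sum-cong-≋ (λ l → *-comm (c l) _)))
      where
      v : Vector Carrier (n ℕ.* d)
      v k = u (quotient d k) (remainder {n} d k)

      blocks-v : ∀ i x → blocks v i x ≡ u i x
      blocks-v i x = cong (λ q → u (proj₁ q) (proj₂ q)) (Fin.remQuot-combine i x)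

      blocks-flat : Flat s (blocks v)
      blocks-flat {i} {j} e x = ≈-trans (reflexive (blocks-v i x))
        (≈-trans (u-flat e x) (▷-congʳ (σ s e) (λ y → reflexive (≡.sym (blocks-v j y))) x))

  -- The frame at `i` is square and injective, hence invertible. The product `W` along a closed walk
  -- fixes this frame, so `W ≋ 𝕀`.
  fullNullity⇒consistent : Connected → ∀ {d} (s : Signature G d) → HasNullity (laplacian s) d → Consistent s
  fullNullity⇒consistent connected s nullity {i} p _ =
    let B , KB≋𝕀 , _ = injective⇒invertible (kernelFrame i) (kernelFrame-injective i)
        W = walkProduct s p
    in ≋-trans (≋-sym (·-identityʳ W)) $
       ≋-trans (·-congˡ (≋-sym KB≋𝕀)) $
       ≋-trans (≋-sym (·-assoc W (kernelFrame i) B)) $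
       ≋-trans (·-congʳ (≋-sym (transport s kernelFrame kernelFrame-flat p))) KB≋𝕀
    where open KernelFrame connected s nullity

  inconsistent⇒nullity< : Connected → ∀ {d ρ} (s : Signature G d) → Inconsistent s →
                          HasNullity (laplacian s) ρ → ρ < d
  inconsistent⇒nullity< connected {d} {ρ} s inconsistent nullity with ℕ.<-cmp ρ d
  ... | tri< ρ<d _ _ = ρ<d
  ... | tri≈ _ refl _ = ⊥-elim (inconsistent (fullNullity⇒consistent connected s nullity))
  -- The base point `i` of the supposed cycle supplies a vertex, where a frame with more columns
  -- than rows cannot be injective.
  ... | tri> _ _ d<ρ = ⊥-elim (inconsistent λ {i} _ _ →
          let v , (l , vl≉0) , ker = wide-kernel d<ρ (kernelFrame i)
          in contradiction (kernelFrame-injective i v ker l) vl≉0)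
    where open KernelFrame connected s nullity

  -- Block matrices and frames put side by side.

  ⨁ι¹≋𝕀 : ∀ k {i j} (e : i ∼ j) → σ (⨁ {G = G} k (λ _ → ι¹)) e ≋ 𝕀
  ⨁ι¹≋𝕀 zero    e ()
  ⨁ι¹≋𝕀 (suc k) e = ≋-trans (⊞-cong ones (⨁ι¹≋𝕀 k e)) (𝕀⊞𝕀 1 k)
    where
    ones : (λ _ _ → 1#) ≋ 𝕀 {1}
    ones zero zero = ≈-refl

  infixr 6 _∥_
  _∥_ : ∀ {d m k} → Matrix d m → Matrix d k → Matrix d (m ℕ.+ k)
  _∥_ {m = m} A B x y = [ A x , B x ]′ (splitAt m y)

  left : ∀ {d} m {k} → Matrix d (m ℕ.+ k) → Matrix d m
  left m {k} A x y = A x (y ↑ˡ k)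

  right : ∀ {d} m {k} → Matrix d (m ℕ.+ k) → Matrix d k
  right m A x y = A x (m ↑ʳ y)

  left-∥ : ∀ {d m k} (A : Matrix d m) (B : Matrix d k) → left m (A ∥ B) ≋ A
  left-∥ {m = m} {k} A B x y = reflexive (cong [ A x , B x ]′ (Fin.splitAt-↑ˡ m y k))

  right-∥ : ∀ {d m k} (A : Matrix d m) (B : Matrix d k) → right m (A ∥ B) ≋ B
  right-∥ {m = m} {k} A B x y = reflexive (cong [ A x , B x ]′ (Fin.splitAt-↑ʳ m k y))

  ∥-orthonormal : ∀ {d m k} (A : Matrix d m) (B : Matrix d k) →
                  A ᵀ · A ≋ 𝕀 → B ᵀ · B ≋ 𝕀 → A ⊥ B → (A ∥ B) ᵀ · (A ∥ B) ≋ 𝕀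
  ∥-orthonormal {d} {m} {k} A B AᵀA BᵀB A⊥B y z =
    ≈-trans (entries (splitAt m y) (splitAt m z)) (𝕀⊞𝕀 m k y z)
    where
    entries : ∀ u v → ∑[ x < d ] ([ A x , B x ]′ u * [ A x , B x ]′ v) ≈ blockEntry 𝕀 𝕀 u v
    entries (inj₁ i) (inj₁ j) = AᵀA i j
    entries (inj₁ i) (inj₂ j) = A⊥B i j
    entries (inj₂ i) (inj₁ j) = ≈-trans (sum-cong-≋ (λ x → *-comm (B x i) (A x j))) (A⊥B j i)
    entries (inj₂ i) (inj₂ j) = BᵀB i j

  𝕀-join : ∀ m k (u v : Fin m ⊎ Fin k) → 𝕀 (join m k u) (join m k v) ≈ blockEntry 𝕀 𝕀 u v
  𝕀-join m k u v = ≈-trans (≈-sym (𝕀⊞𝕀 m k (join m k u) (join m k v)))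
    (reflexive (cong₂ (blockEntry 𝕀 𝕀) (Fin.splitAt-join m k u) (Fin.splitAt-join m k v)))

  -- Splitting off the trivial summand in an adapted orthonormal frame.

  module Splitting (connected : Connected) (r : Fin n) {ρ d′ : ℕ} (s : Signature G (ρ ℕ.+ d′))
                   (K : Fin n → Matrix (ρ ℕ.+ d′) ρ) (K-flat : FlatFrame s K)
                   (C : Matrix ρ ρ) (C-orthonormal : (K r · C) ᵀ · (K r · C) ≋ 𝕀)
                   (P : Matrix (ρ ℕ.+ d′) d′) (P-orthonormal : P ᵀ · P ≋ 𝕀) (K⊥P : K r ⊥ P) where

    d = ρ ℕ.+ d′

    walk : Fin n → Matrix d d
    walk i = walkProduct s (connected i r)

    -- The coefficients `C`, chosen to orthonormalise at `r`, are used at every vertex; this keeps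
    -- `Q` flat.
    Q : Fin n → Matrix d ρ
    Q i = K i · C

    Q-flat : FlatFrame s Q
    Q-flat {i} {j} e = ≋-trans (·-congʳ (K-flat e)) (·-assoc (σ s e) (K j) C)

    Q⊥P : Q r ⊥ P
    Q⊥P i j = begin
      (Q r ᵀ · P) i j            ≈⟨ ·-congʳ {B = P} (ᵀ-· (K r) C) i j ⟩
      ((C ᵀ · K r ᵀ) · P) i j    ≈⟨ ·-assoc (C ᵀ) (K r ᵀ) P i j ⟩
      (C ᵀ · (K r ᵀ · P)) i j    ≈⟨ ▷-zero (C ᵀ) {λ l → (K r ᵀ · P) l j} (λ l → K⊥P l j) i ⟩
      0#                         ∎
      where open ≈-Reasoning

    -- The orthonormal frame at `r`, carried to `i` along the walk that connectedness provides.
    F : Fin n → Matrix d d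
    F i = walk i · (Q r ∥ P)

    F-orthogonal : ∀ i → Orthogonal (F i)
    F-orthogonal i = orthonormal-columns⇒orthogonal (F i) (≋-trans
      (gram-cancel (walk i) (Q r ∥ P) (Q r ∥ P) (walkProduct-isometry s (connected i r)))
      (∥-orthonormal (Q r) P C-orthonormal P-orthonormal Q⊥P))

    -- Flatness of `Q` makes the transport of its columns independent of the chosen walk.
    left-F : ∀ i → left ρ (F i) ≋ Q i
    left-F i = ≋-trans (·-congˡ (left-∥ (Q r) P)) (≋-sym (transport s Q Q-flat (connected i r)))

    -- The matrix of `σ s e` with respect to the frames at the two endpoints.
    T : ∀ {i j} → i ∼ j → Matrix d d
    T {i} {j} e = F i ᵀ · (σ s e · F j)

    T-isometry : ∀ {i j} (e : i ∼ j) → T e ᵀ · T e ≋ 𝕀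
    T-isometry {i} {j} e =
      ≋-trans (gram-cancel (F i ᵀ) (σ s e · F j) (σ s e · F j) (proj₁ (F-orthogonal i))) $
      ≋-trans (gram-cancel (σ s e) (F j) (F j) (proj₂ (orthogonal s e))) (proj₂ (F-orthogonal j))

    T-reversal : ∀ {i j} (e : i ∼ j) → T (∼-sym e) ≋ T e ᵀ
    T-reversal {i} {j} e = ≋-sym $
      ≋-trans (ᵀ-· (F i ᵀ) (σ s e · F j)) $
      ≋-trans (·-congʳ (ᵀ-· (σ s e) (F j))) $
      ≋-trans (·-assoc (F j ᵀ) (σ s e ᵀ) (F i)) $
      ·-congˡ (·-congʳ (≋-sym (reversal s e)))

    -- Along the edge, `σ s e` sends the first `ρ` frame vectors at `j` to those at `i`, whose
    -- coordinates in the frame at `i` are unit vectors.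
    left-T : ∀ {i j} (e : i ∼ j) → left ρ (T e) ≋ left ρ 𝕀
    left-T {i} {j} e = begin
      F i ᵀ · (σ s e · left ρ (F j))  ≈⟨ ·-congˡ {A = F i ᵀ} (·-congˡ {A = σ s e} (left-F j)) ⟩
      F i ᵀ · (σ s e · Q j)           ≈⟨ ·-congˡ (Q-flat e) ⟨
      F i ᵀ · Q i                     ≈⟨ ·-congˡ (left-F i) ⟨
      F i ᵀ · left ρ (F i)            ≈⟨ (λ x y → proj₂ (F-orthogonal i) x (y ↑ˡ _)) ⟩
      left ρ 𝕀                        ∎
      where open ≋-Reasoning

    τ-matrix : ∀ {i j} → i ∼ j → Matrix d′ d′
    τ-matrix e x y = T e (ρ ↑ʳ x) (ρ ↑ʳ y)

    T-blocks : ∀ {i j} (e : i ∼ j) → T e ≋ 𝕀 ⊞ τ-matrix e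
    T-blocks e x y = ≡.subst₂ (λ x′ y′ → T e x′ y′ ≈ (𝕀 ⊞ τ-matrix e) x y)
        (Fin.join-splitAt ρ d′ x) (Fin.join-splitAt ρ d′ y) (entries (splitAt ρ x) (splitAt ρ y))
      where
      entries : ∀ u v → T e (join ρ d′ u) (join ρ d′ v) ≈ blockEntry 𝕀 (τ-matrix e) u v
      entries (inj₁ i) (inj₁ j) = ≈-trans (left-T e (i ↑ˡ d′) j) (𝕀-join ρ d′ (inj₁ i) (inj₁ j))
      entries (inj₂ i) (inj₁ j) = ≈-trans (left-T e (ρ ↑ʳ i) j) (𝕀-join ρ d′ (inj₂ i) (inj₁ j))
      -- The upper right block is the transposed lower left block of the reversed edge, to which
      -- `left-T` applies.
      entries (inj₁ i) (inj₂ j) = ≈-trans (≈-sym (T-reversal e (ρ ↑ʳ j) (i ↑ˡ d′)))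
        (≈-trans (left-T (∼-sym e) (ρ ↑ʳ j) i) (𝕀-join ρ d′ (inj₂ j) (inj₁ i)))
      entries (inj₂ i) (inj₂ j) = ≈-refl

    -- The last `d′` columns of `T e` are zero in their first `ρ` rows, so their inner products are
    -- those of the columns of `τ-matrix e`.
    τ-isometry : ∀ {i j} (e : i ∼ j) → τ-matrix e ᵀ · τ-matrix e ≋ 𝕀
    τ-isometry e x y = begin
      (τ-matrix e ᵀ · τ-matrix e) x y
        ≈⟨ +-identityˡ _ ⟨
      0# + (τ-matrix e ᵀ · τ-matrix e) x y
        ≈⟨ +-congʳ (sum-zero (λ k → T e (k ↑ˡ d′) (ρ ↑ʳ x) * T e (k ↑ˡ d′) (ρ ↑ʳ y)) (λ k →
             ≈-trans (*-congʳ (upper≈0 k)) (zeroˡ _))) ⟨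
      ∑[ k < ρ ] (T e (k ↑ˡ d′) (ρ ↑ʳ x) * T e (k ↑ˡ d′) (ρ ↑ʳ y)) + (τ-matrix e ᵀ · τ-matrix e) x y
        ≈⟨ sum-splitAt ρ (λ k → T e k (ρ ↑ʳ x) * T e k (ρ ↑ʳ y)) ⟨
      (T e ᵀ · T e) (ρ ↑ʳ x) (ρ ↑ʳ y)
        ≈⟨ T-isometry e (ρ ↑ʳ x) (ρ ↑ʳ y) ⟩
      𝕀 (ρ ↑ʳ x) (ρ ↑ʳ y)
        ≈⟨ 𝕀-join ρ d′ (inj₂ x) (inj₂ y) ⟩
      𝕀 x y ∎
      where
      open ≈-Reasoning

      upper≈0 : ∀ k → T e (k ↑ˡ d′) (ρ ↑ʳ x) ≈ 0#
      upper≈0 k = ≈-trans (T-blocks e (k ↑ˡ d′) (ρ ↑ʳ x))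
        (reflexive (cong₂ (blockEntry 𝕀 (τ-matrix e)) (Fin.splitAt-↑ˡ ρ k d′) (Fin.splitAt-↑ʳ ρ d′ x)))

    τ : Signature G d′
    τ = record
      { σ          = τ-matrix
      ; orthogonal = λ e → orthonormal-columns⇒orthogonal (τ-matrix e) (τ-isometry e)
      ; reversal   = λ e x y → T-reversal e (ρ ↑ʳ x) (ρ ↑ʳ y)
      }

    -- The switching function passes to coordinates in the frame, which is multiplication by
    -- `F i ᵀ`.
    switching : s ≅ ⨁ ρ (λ _ → ι¹) ⊕ τ
    switching = (λ i → F i ᵀ) , (λ i → proj₂ (F-orthogonal i) , proj₁ (F-orthogonal i)) , intertwines
      where
      open ≋-Reasoning

      intertwines : ∀ {i j} (e : i ∼ j) → F i ᵀ · σ s e ≋ σ (⨁ ρ (λ _ → ι¹) ⊕ τ) e · F j ᵀ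
      intertwines {i} {j} e = begin
        F i ᵀ · σ s e                     ≈⟨ ·-identityʳ (F i ᵀ · σ s e) ⟨
        F i ᵀ · σ s e · 𝕀                 ≈⟨ ·-congˡ (proj₁ (F-orthogonal j)) ⟨
        F i ᵀ · σ s e · (F j · F j ᵀ)     ≈⟨ ·-assoc (F i ᵀ · σ s e) (F j) (F j ᵀ) ⟨
        F i ᵀ · σ s e · F j · F j ᵀ       ≈⟨ ·-congʳ (·-assoc (F i ᵀ) (σ s e) (F j)) ⟩
        T e · F j ᵀ                       ≈⟨ ·-congʳ (T-blocks e) ⟩
        (𝕀 ⊞ τ-matrix e) · F j ᵀ          ≈⟨ ·-congʳ (⊞-cong (⨁ι¹≋𝕀 ρ e) ≋-refl) ⟨
        (σ (⨁ {G = G} ρ (λ _ → ι¹)) e ⊞ τ-matrix e) · F j ᵀ  ∎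

    σF≋FT : ∀ {i j} (e : i ∼ j) → σ s e · F j ≋ F i · T e
    σF≋FT {i} {j} e = ≋-sym (≋-trans (≋-sym (·-assoc (F i) (F i ᵀ) (σ s e · F j)))
      (≋-trans (·-congʳ (proj₁ (F-orthogonal i))) (·-identityˡ _)))

    -- Frame and kernel values are carried from `r` by the same isometry, so the coordinates of
    -- `K i` are those found at `r`.
    FᵀK≋ : ∀ i → F i ᵀ · K i ≋ (Q r ∥ P) ᵀ · K r
    FᵀK≋ i = ≋-trans (·-congˡ (transport s K K-flat (connected i r)))
      (gram-cancel (walk i) (Q r ∥ P) (K r) (walkProduct-isometry s (connected i r)))

    -- A kernel vector padded by `ρ` zeros and read in the frames `F` is flat for `s`, hence of the
    -- form `K i ▷ c`. Its last `d′` coordinates are then products of `P` with `K r`, which vanish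
    -- by `K⊥P`.
    τ-kernel : (∀ u → Flat s u → ∃[ c ] ∀ i x → u i x ≈ (K i ▷ c) x) → Injective (laplacian τ)
    τ-kernel spanning v Lv≈0 k = ≡.subst (λ k → v k ≈ 0#) (Fin.combine-remQuot {n} d′ k)
        (vanish (quotient d′ k) (remainder {n} d′ k))
      where
      open ≈-Reasoning

      u = blocks v

      z : Fin n → Vector Carrier d
      z i y = [ (λ _ → 0#) , u i ]′ (splitAt ρ y)

      z-right : ∀ i y → z i (ρ ↑ʳ y) ≡ u i y
      z-right i y = cong [ (λ _ → 0#) , u i ]′ (Fin.splitAt-↑ʳ ρ d′ y)

      z-flat : ∀ {i j} (e : i ∼ j) x → z i x ≈ (T e ▷ z j) x
      z-flat {i} {j} e x = ≈-sym (begin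
        (T e ▷ z j) x
          ≈⟨ ▷-congˡ (z j) (T-blocks e) x ⟩
        (𝕀 ⊞ τ-matrix e ▷ z j) x
          ≈⟨ sum-splitAt ρ (λ y → (𝕀 ⊞ τ-matrix e) x y * z j y) ⟩
        ∑[ y < ρ ] ((𝕀 ⊞ τ-matrix e) x (y ↑ˡ d′) * z j (y ↑ˡ d′)) +
        ∑[ y < d′ ] ((𝕀 ⊞ τ-matrix e) x (ρ ↑ʳ y) * z j (ρ ↑ʳ y))
          ≈⟨ +-cong (sum-zero (λ y → (𝕀 ⊞ τ-matrix e) x (y ↑ˡ d′) * z j (y ↑ˡ d′)) (λ y →
                       ≈-trans (*-congˡ (reflexive (cong [ (λ _ → 0#) , u j ]′ (Fin.splitAt-↑ˡ ρ y d′)))) (zeroʳ _)))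
                    (sum-cong-≋ (λ y → *-cong
                       (reflexive (cong (blockEntry 𝕀 (τ-matrix e) (splitAt ρ x)) (Fin.splitAt-↑ʳ ρ d′ y)))
                       (reflexive (z-right j y)))) ⟩
        0# + ∑[ y < d′ ] (blockEntry 𝕀 (τ-matrix e) (splitAt ρ x) (inj₂ y) * u j y)
          ≈⟨ +-identityˡ _ ⟩
        ∑[ y < d′ ] (blockEntry 𝕀 (τ-matrix e) (splitAt ρ x) (inj₂ y) * u j y)
          ≈⟨ rows (splitAt ρ x) ⟩
        z i x ∎)
        where
        rows : ∀ x → ∑[ y < d′ ] (blockEntry (𝕀 {ρ}) (τ-matrix e) x (inj₂ y) * u j y)
                   ≈ [ (λ _ → 0#) , u i ]′ x
        rows (inj₁ x) = sum-zero (λ y → 0# * u j y) (λ y → zeroˡ (u j y))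
        rows (inj₂ x) = ≈-sym (kernel⇒flat τ v Lv≈0 e x)

      Fz-flat : Flat s (λ i → F i ▷ z i)
      Fz-flat {i} {j} e x = begin
        (F i ▷ z i) x          ≈⟨ ▷-congʳ (F i) (z-flat e) x ⟩
        (F i ▷ T e ▷ z j) x    ≈⟨ ·-▷ (F i) (T e) (z j) x ⟨
        (F i · T e ▷ z j) x    ≈⟨ ▷-congˡ (z j) (σF≋FT e) x ⟨
        (σ s e · F j ▷ z j) x  ≈⟨ ·-▷ (σ s e) (F j) (z j) x ⟩
        (σ s e ▷ F j ▷ z j) x  ∎

      span = spanning (λ i → F i ▷ z i) Fz-flat

      c = proj₁ span

      vanish : ∀ i y → u i y ≈ 0#
      vanish i y = begin
        u i y                                ≡⟨ z-right i y ⟨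
        z i (ρ ↑ʳ y)                         ≈⟨ sum-𝕀 (ρ ↑ʳ y) (z i) ⟨
        (𝕀 ▷ z i) (ρ ↑ʳ y)                   ≈⟨ ▷-congˡ (z i) (proj₂ (F-orthogonal i)) (ρ ↑ʳ y) ⟨
        (F i ᵀ · F i ▷ z i) (ρ ↑ʳ y)         ≈⟨ ·-▷ (F i ᵀ) (F i) (z i) (ρ ↑ʳ y) ⟩
        (F i ᵀ ▷ F i ▷ z i) (ρ ↑ʳ y)         ≈⟨ ▷-congʳ (F i ᵀ) (proj₂ span i) (ρ ↑ʳ y) ⟩
        (F i ᵀ ▷ K i ▷ c) (ρ ↑ʳ y)           ≈⟨ ·-▷ (F i ᵀ) (K i) c (ρ ↑ʳ y) ⟨
        (F i ᵀ · K i ▷ c) (ρ ↑ʳ y)           ≈⟨ ▷-congˡ c (FᵀK≋ i) (ρ ↑ʳ y) ⟩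
        ((Q r ∥ P) ᵀ · K r ▷ c) (ρ ↑ʳ y)     ≈⟨ sum-zero (λ l → ((Q r ∥ P) ᵀ · K r) (ρ ↑ʳ y) l * c l)
                                                  (λ l → ≈-trans (*-congʳ (PᵀK≈0 l)) (zeroˡ (c l))) ⟩
        0#                                   ∎
        where
        PᵀK≈0 : ∀ l → ((Q r ∥ P) ᵀ · K r) (ρ ↑ʳ y) l ≈ 0#
        PᵀK≈0 l = ≈-trans (sum-cong-≋ (λ x → ≈-trans (*-congʳ (right-∥ (Q r) P x y)) (*-comm (P x y) (K r x l))))
                          (K⊥P l y)

  -- Assembling the decomposition.

  decomposition : Connected → Fin n → ∀ {d ρ d′} (eq : ρ ℕ.+ d′ ≡ d) (s : Signature G d) →
                  HasNullity (laplacian s) ρ →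
                  Σ[ τ ∈ Signature G d′ ]
                    Invertible (laplacian τ) × s ≅ subst (Signature G) eq (⨁ ρ (λ _ → ι¹) ⊕ τ)
  -- Keeping the dimension equation general allows a match on `refl`, which removes the `subst`.
  decomposition connected r {ρ = ρ} {d′} refl s nullity =
    -- A matrix with no columns imposes no constraint, so all `ρ` dimensions of the kernel values at
    -- `r` are orthonormalised.
    let C , C-orthonormal , _ = gram-schmidt (kernelFrame r) (kernelFrame-injective r) (λ _ ()) ρ ℕ.≤-refl
        -- With `𝕀` as ambient basis, avoiding the `ρ` kernel values leaves room for exactly `d′`
        -- further vectors.
        P , P-orthonormal , K⊥P = gram-schmidt 𝕀 (left-inverse⇒injective 𝕀 𝕀 (·-identityˡ 𝕀))
                                (kernelFrame r) d′ ℕ.≤-refl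
        module S = Splitting connected r s kernelFrame kernelFrame-flat
                     C C-orthonormal (𝕀 · P) P-orthonormal K⊥P
    in S.τ , injective⇒invertible (laplacian S.τ) (S.τ-kernel kernelFrame-spanning) , S.switching
    where open KernelFrame connected s nullity

theorem2p9 : ∀ {a : Level} (ℝ : RealNumbers a) → let open Connection ℝ in
    ∀ (n : ℕ) (G : WeightedGraph n) → WeightedGraph.Connected G →
    ∀ (d : ℕ) (σ : Signature G d) → Inconsistent σ →
    ∀ (ρ : ℕ) → HasNullity (laplacian σ) ρ →
    Σ[ ρ<d ∈ ρ < d ] Σ[ τ ∈ Signature G (d ∸ ρ) ]
    Invertible (laplacian τ) ×
    σ ≅ subst (Signature G) (m+[n∸m]≡n (<⇒≤ ρ<d)) (⨁ ρ (λ _ → ι¹) ⊕ τ)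
-- Without vertices there is no closed walk, so every signature is consistent.
theorem2p9 ℝ zero G connected d σ inconsistent ρ nullity = ⊥-elim (inconsistent λ { {()} })
theorem2p9 ℝ (suc n) G connected d σ inconsistent ρ nullity =
  let ρ<d = inconsistent⇒nullity< connected σ inconsistent nullity
  in ρ<d , decomposition connected zero (m+[n∸m]≡n (<⇒≤ ρ<d)) σ nullity
  where open Transport ℝ G
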